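{- There exist a constant $c>0$ and an integer $n_0$ such that for all integers $n\ge n_0$, $$E_2(n)\geq c\,n\sqrt{\log n},\qquad M_2(n,n)\geq c\,n\sqrt{\log n},\qquad W_2(n)\geq c\,n\sqrt{\log n}.$$ That is, $E_2(n)$, $M_2(n,n)$ and $W_2(n)$ are all in $\Omega(n\sqrt{\log n})$.
   Context: A set of points in $\mathbf{R}^d$ is convexly independent if it is the vertex set of its convex hull, i.e. no point of it lies in the convex hull of the others. $E_d(n)$: for a finite set $P\subset\mathbf{R}^d$, let $E(P)$ be the maximum number of (unordered) pairs of distinct points of $P$ such that the midpoints of these pairs are convexly independent (distinct pairs selected having distinct midpoints); $E_d(n)=\max\{E(P): P\subset\mathbf{R}^d, |P|=n\}$. $M_d(m,n)$: the maximum size of a convexly independent subset of the Minkowski sum $P+Q=\{p+q: p\in P,q\in Q\}$, the maximum being over all sets $P$ of $m$ points and $Q$ of $n$ points in $\mathbf{R}^d$. $W_d(n)$: the maximum number of pairwise nonparallel segments of unit length (measured in the norm) with both endpoints in a set of $n$ points, the maximum being over all sets of $n$ points in $\mathbf{R}^d$ and all strictly convex norms on $\mathbf{R}^d$ (a norm is strictly convex if its unit sphere contains no nondegenerate line segment). -}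

module Defs where

open import Level using (0ℓ; suc)
open import Algebra.Core using (Op₁; Op₂)
open import Algebra.Bundles using (CommutativeRing)
open import Algebra.Structures using (IsCommutativeRing)
import Algebra.Definitions.RawMonoid as RawMonoidDefinitions
import Algebra.Properties.AbelianGroup as AbelianGroupProperties
import Algebra.Properties.Ring as RingProperties
import Algebra.Properties.Monoid.Mult as MonoidMult
open import Data.Fin.Base as Fin using (Fin)
open import Data.Nat.Base as ℕ using (ℕ; zero)
import Data.Nat.Properties as ℕₚ
open import Data.Product.Base using (Σ-syntax; ∃; ∃-syntax; _×_; _,_; proj₁; proj₂)
open import Data.Sum.Base using (_⊎_; inj₁; inj₂; [_,_]′)
open import Data.Vec.Functional using (Vector; zipWith; map)
import Data.Vec.Functional.Relation.Binary.Equality.Setoid as VectorEquality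
open import Function.Definitions using (Injective)
open import Relation.Binary.Bundles using (Setoid)
open import Relation.Binary.Core using (Rel)
import Relation.Binary.Construct.NonStrictToStrict as NonStrictToStrict
open import Relation.Binary.PropositionalEquality.Core as ≡ using (_≡_; _≢_)
open import Relation.Binary.Structures using (IsTotalOrder)
open import Relation.Nullary.Negation.Core using (¬_; contradiction)
open import Relation.Unary using (Pred; _∈_; _⊆_; Satisfiable)

module _ {A : Set} (_≤_ : Rel A 0ℓ) where

  IsUpperBound : Pred A 0ℓ → A → Set
  IsUpperBound S b = ∀ x → x ∈ S → x ≤ b

  IsSupremum : Pred A 0ℓ → A → Set
  IsSupremum S s = IsUpperBound S s × (∀ b → IsUpperBound S b → s ≤ b)

  IsMaximum : Pred A 0ℓ → A → Set
  IsMaximum S m = m ∈ S × IsUpperBound S m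

-- The real numbers are characterised, up to isomorphism, as a Dedekind
-- complete ordered field.

record CompleteOrderedField : Set (suc 0ℓ) where
  infix  8 -_
  infixl 7 _*_
  infixl 6 _+_
  infix  4 _≈_ _≤_
  field
    Carrier           : Set
    _≈_               : Rel Carrier 0ℓ
    _≤_               : Rel Carrier 0ℓ
    _+_               : Op₂ Carrier
    _*_               : Op₂ Carrier
    -_                : Op₁ Carrier
    0#                : Carrier
    1#                : Carrier
    isCommutativeRing : IsCommutativeRing _≈_ _+_ _*_ -_ 0# 1#
    0#≉1#             : ¬ 0# ≈ 1#
    inverse           : ∀ x → ¬ x ≈ 0# → ∃[ y ] x * y ≈ 1#
    isTotalOrder      : IsTotalOrder _≈_ _≤_
    +-monoʳ-≤         : ∀ x {y z} → y ≤ z → x + y ≤ x + z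
    *-nonneg          : ∀ {x y} → 0# ≤ x → 0# ≤ y → 0# ≤ x * y
    complete          : ∀ (S : Pred Carrier 0ℓ) → Satisfiable S →
                        ∃ (IsUpperBound _≤_ S) → ∃ (IsSupremum _≤_ S)

  commutativeRing : CommutativeRing 0ℓ 0ℓ
  commutativeRing = record { isCommutativeRing = isCommutativeRing }

  open NonStrictToStrict _≈_ _≤_ public using (_<_)

module OrderedFieldProperties (ℝ : CompleteOrderedField) where

  open CompleteOrderedField ℝ
  open CommutativeRing commutativeRing hiding (Carrier; _≈_; _+_; _*_; -_; 0#; 1#)
  open IsTotalOrder isTotalOrder using (total; antisym; ≤-respˡ-≈; ≤-respʳ-≈)
    renaming (refl to ≤-refl; trans to ≤-trans)
  open RawMonoidDefinitions +-rawMonoid using () renaming (_×_ to _·_)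

  +-monoˡ-≤ : ∀ x {y z} → y ≤ z → y + x ≤ z + x
  +-monoˡ-≤ x y≤z = ≤-respˡ-≈ (+-comm x _) (≤-respʳ-≈ (+-comm x _) (+-monoʳ-≤ x y≤z))

  +-mono-≤ : ∀ {w x y z} → w ≤ x → y ≤ z → w + y ≤ x + z
  +-mono-≤ {x = x} {y = y} w≤x y≤z = ≤-trans (+-monoˡ-≤ y w≤x) (+-monoʳ-≤ x y≤z)

  +-cancelʳ-≤ : ∀ {x y} z → x + z ≤ y + z → x ≤ y
  +-cancelʳ-≤ z p = ≤-respˡ-≈ (cancel _) (≤-respʳ-≈ (cancel _) (+-monoˡ-≤ (- z) p))
    where
    cancel : ∀ w → (w + z) - z ≈ w
    cancel w = trans (+-assoc w z (- z)) (trans (+-congˡ (-‿inverseʳ z)) (+-identityʳ w))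

  0≤1 : 0# ≤ 1#
  0≤1 with total 0# 1#
  ... | inj₁ p = p
  ... | inj₂ p = ≤-respʳ-≈ (trans (sym (-‿distribˡ-* 1# (- 1#)))
                   (trans (-‿cong (*-identityˡ (- 1#))) (⁻¹-involutive 1#)))
                   (*-nonneg q q)
    where
    open RingProperties ring using (-‿distribˡ-*)
    open AbelianGroupProperties +-abelianGroup using (⁻¹-involutive)
    q : 0# ≤ - 1#
    q = ≤-respˡ-≈ (-‿inverseʳ 1#) (≤-respʳ-≈ (+-identityˡ (- 1#)) (+-monoˡ-≤ (- 1#) p))

  2≉0 : ¬ 1# + 1# ≈ 0#
  2≉0 1+1≈0 = contradiction
    (antisym 0≤1 (≤-respˡ-≈ (+-identityʳ 1#) (≤-respʳ-≈ 1+1≈0 (+-monoʳ-≤ 1# 0≤1))))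
    0#≉1#

  x≤x*x : ∀ {x} → 1# ≤ x → x ≤ x * x
  x≤x*x {x} 1≤x = ≤-respˡ-≈ (+-identityˡ x) (≤-respʳ-≈ eq (+-monoˡ-≤ x 0≤xd))
    where
    d : Carrier
    d = x - 1#
    0≤d : 0# ≤ d
    0≤d = ≤-respˡ-≈ (-‿inverseʳ 1#) (+-monoˡ-≤ (- 1#) 1≤x)
    0≤xd : 0# ≤ x * d
    0≤xd = *-nonneg (≤-trans 0≤1 1≤x) 0≤d
    eq : x * d + x ≈ x * x
    eq = trans (+-congˡ (sym (*-identityʳ x))) (trans (sym (distribˡ x d 1#))
           (*-congˡ (trans (+-assoc x (- 1#) 1#)
             (trans (+-congˡ (-‿inverseˡ 1#)) (+-identityʳ x)))))

  ·1-nonneg : ∀ n → 0# ≤ n · 1#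
  ·1-nonneg zero      = ≤-refl
  ·1-nonneg (ℕ.suc n) = ≤-respˡ-≈ (+-identityʳ 0#) (+-mono-≤ 0≤1 (·1-nonneg n))

  ·1-mono : ∀ {m n} → m ℕ.≤ n → m · 1# ≤ n · 1#
  ·1-mono {n = n} ℕ.z≤n = ·1-nonneg n
  ·1-mono (ℕ.s≤s m≤n)   = +-monoʳ-≤ 1# (·1-mono m≤n)

  ·-mono-≤ : ∀ n {x y} → x ≤ y → n · x ≤ n · y
  ·-mono-≤ zero      x≤y = ≤-refl
  ·-mono-≤ (ℕ.suc n) x≤y = +-mono-≤ x≤y (·-mono-≤ n x≤y)

  ·-cancel-≤ : ∀ q {x y} → 1 ℕ.≤ q → q · x ≤ q · y → x ≤ y
  ·-cancel-≤ (ℕ.suc q) {x} {y} _ p with total x y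
  ... | inj₁ x≤y = x≤y
  ... | inj₂ y≤x = +-cancelʳ-≤ (q · y) (≤-trans (+-monoʳ-≤ x (·-mono-≤ q y≤x)) p)

  n≤2^n : ∀ n → n ℕ.≤ 2 ℕ.^ n
  n≤2^n zero      = ℕ.z≤n
  n≤2^n (ℕ.suc n) = ≡.subst (ℕ.suc n ℕ.≤_) (≡.cong ((2 ℕ.^ n) ℕ.+_) (≡.sym (ℕₚ.+-identityʳ _)))
    (ℕₚ.+-mono-≤ (ℕₚ.m^n>0 2 n) (n≤2^n n))

  exponent-bound : ∀ n p q → 2 ℕ.^ p ℕ.≤ n ℕ.^ q → p ℕ.≤ q ℕ.* n
  exponent-bound n p q h = ℕₚ.≮⇒≥ λ qn<p → ℕₚ.<⇒≱
    (ℕₚ.^-monoʳ-< 2 (ℕ.s≤s (ℕ.s≤s ℕ.z≤n)) qn<p)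
    (ℕₚ.≤-trans h (ℕₚ.≤-trans (ℕₚ.^-monoˡ-≤ q (n≤2^n n))
      (ℕₚ.≤-reflexive (≡.trans (ℕₚ.^-*-assoc 2 n q) (≡.cong (2 ℕ.^_) (ℕₚ.*-comm n q))))))

module RealNumbers (ℝ : CompleteOrderedField) where

  open CompleteOrderedField ℝ
  open CommutativeRing commutativeRing hiding (Carrier; _≈_; _+_; _*_; -_; 0#; 1#)
  open IsTotalOrder isTotalOrder using (total; ≤-respˡ-≈; ≤-respʳ-≈)
    renaming (trans to ≤-trans)
  open RawMonoidDefinitions +-rawMonoid public using (sum) renaming (_×_ to _·_)

  open OrderedFieldProperties ℝ

  fromℕ : ℕ → Carrier
  fromℕ n = n · 1#

  ∣_∣ : Carrier → Carrier
  ∣ x ∣ = [ (λ _ → x) , (λ _ → - x) ]′ (total 0# x)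

  ½ : Carrier
  ½ = proj₁ (inverse (1# + 1#) 2≉0)

  -- √ x is 0# for negative x.

  SqrtBelow : Carrier → Pred Carrier 0ℓ
  SqrtBelow x y = y ≈ 0# ⊎ y * y ≤ x

  √-supremum : ∀ x → ∃ (IsSupremum _≤_ (SqrtBelow x))
  √-supremum x = complete (SqrtBelow x) (0# , inj₁ refl) bound
    where
    bound : ∃ (IsUpperBound _≤_ (SqrtBelow x))
    bound with total 1# x
    ... | inj₁ 1≤x = x , λ where
      y (inj₁ y≈0)  → ≤-respˡ-≈ (sym y≈0) (≤-trans 0≤1 1≤x)
      y (inj₂ yy≤x) → [ (λ y≤1 → ≤-trans y≤1 1≤x)
                      , (λ 1≤y → ≤-trans (x≤x*x 1≤y) yy≤x) ]′ (total y 1#)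
    ... | inj₂ x≤1 = 1# , λ where
      y (inj₁ y≈0)  → ≤-respˡ-≈ (sym y≈0) 0≤1
      y (inj₂ yy≤x) → [ (λ y≤1 → y≤1)
                      , (λ 1≤y → ≤-trans (x≤x*x 1≤y) (≤-trans yy≤x x≤1)) ]′ (total y 1#)

  √ : Carrier → Carrier
  √ x = proj₁ (√-supremum x)

  -- The rationals y = p / q with p ≥ 0, q ≥ 1 and 2 ^ y ≤ n.

  Log₂Below : ℕ → Pred Carrier 0ℓ
  Log₂Below n y = ∃[ p ] ∃[ q ] 1 ℕ.≤ q × q · y ≈ fromℕ p × 2 ℕ.^ p ℕ.≤ n ℕ.^ q

  log₂-supremum : ∀ n → 1 ℕ.≤ n → ∃ (IsSupremum _≤_ (Log₂Below n))
  log₂-supremum n 1≤n = complete (Log₂Below n)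
    (0# , 0 , 1 , ℕₚ.≤-refl , +-identityʳ 0# , ≡.subst (1 ℕ.≤_) (≡.sym (ℕₚ.*-identityʳ n)) 1≤n)
    (fromℕ n , λ { y (p , q , 1≤q , qy≈p , h) → ·-cancel-≤ q 1≤q
      (≤-respˡ-≈ (sym qy≈p) (≤-respʳ-≈ (sym (×-assocˡ 1# q n))
        (·1-mono (exponent-bound n p q h)))) })
    where open MonoidMult +-monoid using (×-assocˡ)

  -- log₂ 0 is 0#.  The choice of base only affects constant factors.

  log₂ : ℕ → Carrier
  log₂ zero        = 0#
  log₂ n@(ℕ.suc _) = proj₁ (log₂-supremum n (ℕ.s≤s ℕ.z≤n))

module ConvexGeometry (ℝ : CompleteOrderedField) where

  open CompleteOrderedField ℝ
  open RealNumbers ℝ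
  private
    setoid : Setoid 0ℓ 0ℓ
    setoid = CommutativeRing.setoid commutativeRing
  open VectorEquality setoid public using (_≋_)

  infix  7 _*ᵥ_
  infixl 6 _+ᵥ_ _-ᵥ_

  Point : ℕ → Set
  Point d = Vector Carrier d

  _+ᵥ_ : ∀ {d} → Op₂ (Point d)
  _+ᵥ_ = zipWith _+_

  _-ᵥ_ : ∀ {d} → Op₂ (Point d)
  _-ᵥ_ = zipWith (λ x y → x + - y)

  _*ᵥ_ : ∀ {d} → Carrier → Point d → Point d
  t *ᵥ p = map (t *_) p

  0ᵥ : ∀ {d} → Point d
  0ᵥ _ = 0#

  midpoint : ∀ {d} → Op₂ (Point d)
  midpoint p q = ½ *ᵥ (p +ᵥ q)

  conv : ∀ {d} → Pred (Point d) 0ℓ → Pred (Point d) 0ℓ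
  conv {d} S x =
    ∃[ m ] Σ[ w ∈ Vector Carrier m ] Σ[ y ∈ Vector (Point d) m ]
      (∀ i → 0# ≤ w i) × sum w ≈ 1# × (∀ i → y i ∈ S) ×
      x ≋ (λ j → sum (λ i → w i * y i j))

  _∖_ : ∀ {d} → Pred (Point d) 0ℓ → Point d → Pred (Point d) 0ℓ
  (S ∖ x) y = y ∈ S × ¬ y ≋ x

  ConvexlyIndependent : ∀ {d} → Pred (Point d) 0ℓ → Set
  ConvexlyIndependent S = ∀ x → x ∈ S → ¬ x ∈ conv (S ∖ x)

  record PointSet (d n : ℕ) : Set where
    field
      point    : Fin n → Point d
      distinct : Injective _≡_ _≋_ point

    elements : Pred (Point d) 0ℓ
    elements x = ∃[ i ] x ≋ point i

  open PointSet public

  _⊕_ : ∀ {d} → Pred (Point d) 0ℓ → Pred (Point d) 0ℓ → Pred (Point d) 0ℓ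
  (S ⊕ T) x = ∃[ p ] ∃[ q ] p ∈ S × q ∈ T × x ≋ p +ᵥ q

  -- Ordering the indices makes the pair unordered, with distinct elements.

  IndexPair : ℕ → Set
  IndexPair n = Σ[ i ∈ Fin n ] Σ[ j ∈ Fin n ] i Fin.< j

  midpointOf : ∀ {d n} → PointSet d n → IndexPair n → Point d
  midpointOf P (i , j , _) = midpoint (point P i) (point P j)

  difference : ∀ {d n} → PointSet d n → IndexPair n → Point d
  difference P (i , j , _) = point P i -ᵥ point P j

  -- The point set C consists of the k distinct midpoints of the selected pairs.

  SelectablePairs : ∀ {d n} → PointSet d n → Pred ℕ 0ℓ
  SelectablePairs {d} {n} P k =
    Σ[ e ∈ (Fin k → IndexPair n) ] Σ[ C ∈ PointSet d k ]
      (∀ a → point C a ≋ midpointOf P (e a)) × ConvexlyIndependent (elements C)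

  IsEOf : ∀ {d n} → PointSet d n → ℕ → Set
  IsEOf P = IsMaximum ℕ._≤_ (SelectablePairs P)

  IsE : (d n : ℕ) → ℕ → Set
  IsE d n = IsMaximum ℕ._≤_ (λ k → Σ[ P ∈ PointSet d n ] IsEOf P k)

  IsM : (d m n : ℕ) → ℕ → Set
  IsM d m n = IsMaximum ℕ._≤_ λ k →
    Σ[ P ∈ PointSet d m ] Σ[ Q ∈ PointSet d n ] Σ[ C ∈ PointSet d k ]
      elements C ⊆ (elements P ⊕ elements Q) × ConvexlyIndependent (elements C)

  record Norm (d : ℕ) : Set where
    field
      ‖_‖         : Point d → Carrier
      cong        : ∀ {p q} → p ≋ q → ‖ p ‖ ≈ ‖ q ‖
      nonneg      : ∀ p → 0# ≤ ‖ p ‖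
      definite    : ∀ p → ‖ p ‖ ≈ 0# → p ≋ 0ᵥ
      homogeneous : ∀ t p → ‖ t *ᵥ p ‖ ≈ ∣ t ∣ * ‖ p ‖
      triangle    : ∀ p q → ‖ p +ᵥ q ‖ ≤ ‖ p ‖ + ‖ q ‖

  StrictlyConvex : ∀ {d} → Norm d → Set
  StrictlyConvex N = ¬ (∃[ p ] ∃[ q ] ¬ p ≋ q ×
    (∀ t → 0# ≤ t → t ≤ 1# → ‖ (1# + - t) *ᵥ p +ᵥ t *ᵥ q ‖ ≈ 1#))
    where open Norm N

  -- Only meant for nonzero vectors.

  Parallel : ∀ {d} → Rel (Point d) 0ℓ
  Parallel u v = ∃[ t ] u ≋ t *ᵥ v

  IsW : (d n : ℕ) → ℕ → Set
  IsW d n = IsMaximum ℕ._≤_ λ k →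
    Σ[ N ∈ Norm d ] StrictlyConvex N ×
    Σ[ P ∈ PointSet d n ] Σ[ e ∈ (Fin k → IndexPair n) ]
      (∀ a → Norm.‖_‖ N (difference P (e a)) ≈ 1#) ×
      (∀ a b → a ≢ b → ¬ Parallel (difference P (e a)) (difference P (e b)))

-- All three bounds come from one configuration: points (U , F) and lines F + V U = G of
-- negative slope, with many incidences and pairwise distinct U + V over the incidences.
-- Completing squares, (U , U² − 2F) and (V , V² + 2G) add up to (X , X²), X = U + V, exactly
-- when they are incident.  So the sums, and likewise the midpoints, lie on a parabola and are
-- convexly independent; and after reflecting the second family the differences (X , X² − B)
-- lie on the unit circle |y| = B − x² of a strictly convex norm.
--
-- For the incidences take the base-k digits of the numbers below q kᵏ as points of a
-- k-dimensional grid, projected to the plane so that the number itself is the abscissa.  Points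
-- then have distinct abscissas, each lies on k lines (one per axis) of distinct slopes, and
-- there are as many lines as points.  If k is maximal with 2 kᵏ ≤ n, and q kᵏ is of order n,
-- then k is at least of order √ (log n).

module Submission where

open import Defs
open import Level using (0ℓ)
open import Axiom.ExcludedMiddle using (ExcludedMiddle)
open import Algebra.Bundles using (CommutativeRing)
open import Algebra.Bundles.Raw using (RawRing)
import Algebra.Properties.Semiring.Mult as SemiringMult
import Algebra.Solver.Ring as RingSolver
open import Algebra.Solver.Ring.AlmostCommutativeRing
  using (_-Raw-AlmostCommutative⟶_; fromCommutativeRing)
import Algebra.Solver.Ring.NaturalCoefficients.Default as SemiringSolver
open import Data.Empty using (⊥)
open import Data.Fin.Base as Fin using (Fin; combine; opposite; toℕ)
open import Data.Fin.Patterns using (0F; 1F)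
import Data.Fin.Properties as Finₚ
open import Data.Maybe.Base using (Maybe; just; nothing)
open import Data.Nat.Base as ℕ using (ℕ; zero; suc)
import Data.Nat.DivMod as DivMod
import Data.Nat.Properties as ℕₚ
import Data.Nat.Solver as ℕSolver
open import Data.Product.Base using (Σ-syntax; ∃-syntax; _×_; _,_; proj₁; proj₂)
open import Data.Product.Function.NonDependent.Propositional using (_×-↔_)
open import Data.Sum.Base using (_⊎_; inj₁; inj₂; [_,_]′)
open import Data.Sum.Function.Propositional using (_⊎-↔_)
open import Data.Vec.Functional using (Vector)
open import Function.Base using (_∘_; case_of_)
open import Function.Bundles using (_↔_; Injection; Inverse)
open import Function.Properties.Inverse using (↔-refl; ↔-trans; ↔⇒↣)
open import Relation.Binary.Definitions using (tri<; tri≈; tri>)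
open import Relation.Binary.PropositionalEquality as ≡
  using (_≡_; _≢_; module ≡-Reasoning)
import Relation.Binary.Reasoning.Setoid as SetoidReasoning
open import Relation.Binary.Structures using (IsTotalOrder)
open import Relation.Nullary using (¬_; yes; no; contradiction)
open import Relation.Unary using (Pred; _∈_; _⊆_)

-- Grids, their axis-parallel lines, and a projection to the plane.

module Incidence (k q : ℕ) where
  open import Data.Nat.Base using (_+_; _*_; _∸_; _^_)
  open ≡ using (refl; sym; trans; cong)

  -- The factor `Fin q` is the least significant digit and has no lines along it: it provides `q`
  -- disjoint copies of the grid with side `k`.
  GridPoint : ℕ → Set
  GridPoint zero    = Fin q
  GridPoint (suc d) = Fin k × GridPoint d

  -- A line either stays inside one of the `k` layers of the new axis or runs along that axis, in
  -- which case its base point determines it.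
  Line : ℕ → Set
  Line zero    = ⊥
  Line (suc d) = (Fin k × Line d) ⊎ GridPoint d

  #points : ℕ → ℕ
  #points zero    = q
  #points (suc d) = k * #points d

  #lines : ℕ → ℕ
  #lines zero    = 0
  #lines (suc d) = k * #lines d + #points d

  points↔ : ∀ d → Fin (#points d) ↔ GridPoint d
  points↔ zero    = ↔-refl
  points↔ (suc d) = ↔-trans Finₚ.*↔× (↔-refl ×-↔ points↔ d)

  lines↔ : ∀ d → Fin (#lines d) ↔ Line d
  lines↔ zero    = Finₚ.0↔⊥
  lines↔ (suc d) = ↔-trans Finₚ.+↔⊎
    (↔-trans Finₚ.*↔× (↔-refl ×-↔ lines↔ d) ⊎-↔ points↔ d)

  -- Both sides count incidences: `k` points on each line, `d` lines through each point.
  #lines*k : ∀ d → #lines d * k ≡ d * #points d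
  #lines*k zero    = refl
  #lines*k (suc d) = begin
    (k * #lines d + #points d) * k
      ≡⟨ solve 3 (λ k l p → (k :* l :+ p) :* k := k :* (l :* k) :+ k :* p) refl
           k (#lines d) (#points d) ⟩
    k * (#lines d * k) + k * #points d
      ≡⟨ cong (λ z → k * z + k * #points d) (#lines*k d) ⟩
    k * (d * #points d) + k * #points d
      ≡⟨ solve 3 (λ k d p → k :* (d :* p) :+ k :* p := k :* p :+ d :* (k :* p)) refl
           k d (#points d) ⟩
    suc d * (k * #points d) ∎
    where
    open ≡-Reasoning
    open ℕSolver.+-*-Solver

  #points≡ : ∀ d → #points d ≡ q * k ^ d
  #points≡ zero    = sym (ℕₚ.*-identityʳ q)
  #points≡ (suc d) = trans (cong (k *_) (#points≡ d))
    (solve 3 (λ k q p → k :* (q :* p) := q :* (k :* p)) refl k q (k ^ d))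
    where open ℕSolver.+-*-Solver

  abscissa : ∀ d → GridPoint d → ℕ
  abscissa d = toℕ ∘ Inverse.from (points↔ d)

  -- The ordinate decreases in the new digit, so that no subtraction occurs in the
  -- equation  ordinate + abscissa * slope ≡ intercept  of a line.

  ordinate : ∀ d → GridPoint d → ℕ
  ordinate zero    _       = 0
  ordinate (suc d) (a , x) = (k ∸ toℕ a) * #points d * d + ordinate d x

  -- Minus the slope in the plane: a step along the axis added to dimension `d` raises the abscissa
  -- by `#points d` and lowers the ordinate by `d` times as much.
  slope : ∀ d → Line d → ℕ
  slope (suc d) (inj₁ (_ , l)) = slope d l
  slope (suc d) (inj₂ _)       = d

  -- Layer `a` is projected with a translation of both coordinates, which accounts for the first two
  -- summands of the first clause. The second clause evaluates the equation of the line at its point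
  -- with digit 0.
  intercept : ∀ d → Line d → ℕ
  intercept (suc d) (inj₁ (a , l)) =
    (k ∸ toℕ a) * #points d * d + toℕ a * #points d * slope d l + intercept d l
  intercept (suc d) (inj₂ x) = k * #points d * d + abscissa d x * d + ordinate d x

  line : ∀ d → Fin d → GridPoint d → Line d
  line (suc d) Fin.zero    (_ , x) = inj₂ x
  line (suc d) (Fin.suc j) (a , x) = inj₁ (a , line d j x)

  -- Directions count from the axis added last, slopes from the axis added first. In particular the
  -- lines through one point have distinct slopes.
  slope-line : ∀ d j x → slope d (line d j x) ≡ toℕ (opposite j)
  slope-line (suc d) Fin.zero    _       = sym (Finₚ.toℕ-fromℕ d)
  slope-line (suc d) (Fin.suc j) (_ , x) =
    trans (slope-line d j x) (sym (Finₚ.toℕ-inject₁ (opposite j)))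

  on-line : ∀ d j x →
    ordinate d x + abscissa d x * slope d (line d j x) ≡ intercept d (line d j x)
  on-line (suc d) Fin.zero (a , x) = begin
    (k ∸ toℕ a) * p * d + ordinate d x + abscissa (suc d) (a , x) * d
      ≡⟨ cong (λ z → (k ∸ toℕ a) * p * d + ordinate d x + z * d)
           (Finₚ.toℕ-combine a (Inverse.from (points↔ d) x)) ⟩
    (k ∸ toℕ a) * p * d + ordinate d x + (p * toℕ a + abscissa d x) * d
      ≡⟨ solve 6 (λ c a p d o x → c :* p :* d :+ o :+ (p :* a :+ x) :* d
                   := (c :+ a) :* p :* d :+ x :* d :+ o) refl
           (k ∸ toℕ a) (toℕ a) p d (ordinate d x) (abscissa d x) ⟩
    (k ∸ toℕ a + toℕ a) * p * d + abscissa d x * d + ordinate d x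
      -- The digit `a` drops out here: all `k` points along the new axis get the same intercept.
      ≡⟨ cong (λ z → z * p * d + abscissa d x * d + ordinate d x)
           (ℕₚ.m∸n+n≡m (ℕₚ.<⇒≤ (Finₚ.toℕ<n a))) ⟩
    k * p * d + abscissa d x * d + ordinate d x ∎
    where
    open ≡-Reasoning
    open ℕSolver.+-*-Solver
    p = #points d
  on-line (suc d) (Fin.suc j) (a , x) = begin
    (k ∸ toℕ a) * p * d + ordinate d x + abscissa (suc d) (a , x) * s
      ≡⟨ cong (λ z → (k ∸ toℕ a) * p * d + ordinate d x + z * s)
           (Finₚ.toℕ-combine a (Inverse.from (points↔ d) x)) ⟩
    (k ∸ toℕ a) * p * d + ordinate d x + (p * toℕ a + abscissa d x) * s
      ≡⟨ solve 7 (λ c a p d o x s → c :* p :* d :+ o :+ (p :* a :+ x) :* s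
                   := c :* p :* d :+ a :* p :* s :+ (o :+ x :* s)) refl
           (k ∸ toℕ a) (toℕ a) p d (ordinate d x) (abscissa d x) s ⟩
    (k ∸ toℕ a) * p * d + toℕ a * p * s + (ordinate d x + abscissa d x * s)
      ≡⟨ cong ((k ∸ toℕ a) * p * d + toℕ a * p * s +_) (on-line d j x) ⟩
    (k ∸ toℕ a) * p * d + toℕ a * p * s + intercept d (line d j x) ∎
    where
    open ≡-Reasoning
    open ℕSolver.+-*-Solver
    p = #points d
    s = slope d (line d j x)

-- Incidence configurations and the one obtained from the grid.

record Incidences (#U #V #X : ℕ) : Set where
  field
    U F           : Fin #U → ℕ
    V G           : Fin #V → ℕ
    pointOf       : Fin #X → Fin #U
    lineOf        : Fin #X → Fin #V
    incident      : ∀ a → F (pointOf a) ℕ.+ U (pointOf a) ℕ.* V (lineOf a) ≡ G (lineOf a)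
    -- This keeps the two planar points built from an incidence apart, so that they form a pair; the
    -- next field makes the resulting points of the parabola distinct.
    V<U           : ∀ a → V (lineOf a) ℕ.< U (pointOf a)
    U+V-injective : ∀ a b →
      U (pointOf a) ℕ.+ V (lineOf a) ≡ U (pointOf b) ℕ.+ V (lineOf b) → a ≡ b

module _ (k q : ℕ) where
  open Incidence k q

  -- Scaling the abscissas by k > slope separates the sums of abscissas and slopes.

  gridIncidences : Incidences (#points k) (#lines k) (k ℕ.* #points k)
  gridIncidences = record
    { U = U
    ; F = λ i → k ℕ.* ordinate k (to (points↔ k) i)
    ; V = V
    -- Replacing the abscissa u by k (u + 1) and the ordinate f by k f turns f + u s = g into an
    -- equation with intercept k (g + s).
    ; G = λ l → k ℕ.* (intercept k (to (lines↔ k) l) ℕ.+ V l)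
    ; pointOf = proj₂ ∘ flag
    ; lineOf  = lineOf
    ; incident = λ a → incident′ (ordinate k (grid a)) (on-line′ a)
    ; V<U = λ a → ℕₚ.<-≤-trans (≡.subst (ℕ._< k) (≡.sym (V-lineOf a)) (Finₚ.toℕ<n (direction a)))
        (ℕₚ.m≤m*n k (suc (toℕ (proj₂ (flag a)))))
    ; U+V-injective = λ a b eq →
        let (i≡ , j≡) = Finₚ.combine-injective _ _ _ _ (Finₚ.toℕ-injective
                        (ℕₚ.+-cancelˡ-≡ k _ _ (≡.trans (≡.sym (code a)) (≡.trans eq (code b)))))
        in Injection.injective (↔⇒↣ (Finₚ.*↔× {k} {#points k})) (≡.cong₂ _,_
             (≡.trans (≡.sym (Finₚ.opposite-involutive _))
               (≡.trans (≡.cong opposite j≡) (Finₚ.opposite-involutive _))) i≡)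
    }
    where
    open Inverse using (to; from; strictlyInverseˡ; strictlyInverseʳ)

    flag : Fin (k ℕ.* #points k) → Fin k × Fin (#points k)
    flag = to Finₚ.*↔×

    direction : Fin (k ℕ.* #points k) → Fin k
    direction = opposite ∘ proj₁ ∘ flag

    grid : Fin (k ℕ.* #points k) → GridPoint k
    grid = to (points↔ k) ∘ proj₂ ∘ flag

    lineOf : Fin (k ℕ.* #points k) → Fin (#lines k)
    lineOf a = from (lines↔ k) (line k (proj₁ (flag a)) (grid a))

    U : Fin (#points k) → ℕ
    -- The successor gives `U` the lower bound `k`, above every slope, even at the abscissa 0.
    U i = k ℕ.* suc (toℕ i)

    V : Fin (#lines k) → ℕ
    V = slope k ∘ to (lines↔ k)

    V-lineOf : ∀ a → V (lineOf a) ≡ toℕ (direction a)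
    V-lineOf a = ≡.trans (≡.cong (slope k) (strictlyInverseˡ (lines↔ k) _)) (slope-line k _ _)

    -- The slope is a remainder modulo `k`, so division by `k` recovers both the point and the
    -- direction from the sum.
    code : ∀ a → U (proj₂ (flag a)) ℕ.+ V (lineOf a) ≡
                 k ℕ.+ toℕ (combine (proj₂ (flag a)) (direction a))
    code a = begin
      k ℕ.* suc (toℕ i) ℕ.+ V (lineOf a)           ≡⟨ ≡.cong₂ ℕ._+_ (ℕₚ.*-suc k (toℕ i)) (V-lineOf a) ⟩
      k ℕ.+ k ℕ.* toℕ i ℕ.+ toℕ (direction a)      ≡⟨ ℕₚ.+-assoc k _ _ ⟩
      k ℕ.+ (k ℕ.* toℕ i ℕ.+ toℕ (direction a))    ≡⟨ ≡.cong (k ℕ.+_) (Finₚ.toℕ-combine i (direction a)) ⟨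
      k ℕ.+ toℕ (combine i (direction a)) ∎
      where
      open ≡-Reasoning
      i = proj₂ (flag a)

    on-line′ : ∀ a → ordinate k (grid a) ℕ.+ toℕ (proj₂ (flag a)) ℕ.* V (lineOf a) ≡
                     intercept k (to (lines↔ k) (lineOf a))
    on-line′ a = begin
      ordinate k x ℕ.+ toℕ i ℕ.* slope k (to (lines↔ k) (lineOf a))
        ≡⟨ ≡.cong₂ (λ i l → ordinate k x ℕ.+ toℕ i ℕ.* slope k l)
             (≡.sym (strictlyInverseʳ (points↔ k) i)) (strictlyInverseˡ (lines↔ k) l) ⟩
      ordinate k x ℕ.+ abscissa k x ℕ.* slope k l       ≡⟨ on-line k _ x ⟩
      intercept k l
        ≡⟨ ≡.cong (intercept k) (strictlyInverseˡ (lines↔ k) l) ⟨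
      intercept k (to (lines↔ k) (lineOf a)) ∎
      where
      open ≡-Reasoning
      i = proj₂ (flag a)
      x = grid a
      l = line k (proj₁ (flag a)) x

    incident′ : ∀ f {i s g} → f ℕ.+ i ℕ.* s ≡ g →
      k ℕ.* f ℕ.+ k ℕ.* suc i ℕ.* s ≡ k ℕ.* (g ℕ.+ s)
    incident′ f {i} {s} ≡.refl =
      solve 4 (λ k f i s → k :* f :+ k :* (con 1 :+ i) :* s := k :* (f :+ i :* s :+ s)) ≡.refl k f i s
      where open ℕSolver.+-*-Solver

-- Choice of the grid for a given number of points.

crossing : ∀ (f : ℕ → ℕ) n → f 1 ℕ.≤ n → ∀ m → n ℕ.< f (suc m) →
           ∃[ j ] f (suc j) ℕ.≤ n × n ℕ.< f (suc (suc j))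
crossing f n f1≤n zero    n<f1 = contradiction f1≤n (ℕₚ.<⇒≱ n<f1)
crossing f n f1≤n (suc m) n<f with f (suc m) ℕₚ.≤? n
... | yes fm≤n = m , fm≤n , n<f
... | no  fm≰n = crossing f n f1≤n m (ℕₚ.≰⇒> fm≰n)

n<2^n : ∀ n → n ℕ.< 2 ℕ.^ n
n<2^n zero    = ℕ.s≤s ℕ.z≤n
n<2^n (suc n) = ℕₚ.≤-trans (ℕ.s≤s (n<2^n n)) (ℕₚ.≤-trans
  (ℕₚ.+-monoˡ-≤ (2 ℕ.^ n) (ℕₚ.m^n>0 2 n))
  (ℕₚ.+-monoʳ-≤ (2 ℕ.^ n) (ℕₚ.m≤m+n (2 ℕ.^ n) 0)))

-- From k + 1 ≤ 2ᵏ the left side is at most 2 to the power 1 + k (k + 1), and this exponent is at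
-- most 4 k². The bound is a perfect square because a root of the logarithm is taken later.
2*[1+k]^[1+k]≤ : ∀ k → .{{ℕ.NonZero k}} → 2 ℕ.* suc k ℕ.^ suc k ℕ.≤ 2 ℕ.^ ((2 ℕ.* k) ℕ.* (2 ℕ.* k))
2*[1+k]^[1+k]≤ k@(suc j) = begin
  2 ℕ.* suc k ℕ.^ suc k              ≤⟨ ℕₚ.*-monoʳ-≤ 2 (ℕₚ.^-monoˡ-≤ (suc k) (n<2^n k)) ⟩
  2 ℕ.* (2 ℕ.^ k) ℕ.^ suc k          ≡⟨ ≡.cong (2 ℕ.*_) (ℕₚ.^-*-assoc 2 k (suc k)) ⟩
  2 ℕ.^ suc (k ℕ.* suc k)            ≤⟨ ℕₚ.^-monoʳ-≤ 2 exponent ⟩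
  2 ℕ.^ ((2 ℕ.* k) ℕ.* (2 ℕ.* k)) ∎
  where
  open ℕₚ.≤-Reasoning
  open ℕSolver.+-*-Solver
  exponent : suc (k ℕ.* suc k) ℕ.≤ (2 ℕ.* k) ℕ.* (2 ℕ.* k)
  exponent = ≡.subst (suc (k ℕ.* suc k) ℕ.≤_)
    (solve 1 (λ j →
       con 1 :+ (con 1 :+ j) :* (con 2 :+ j) :+ (con 3 :* (j :* j) :+ con 5 :* j :+ con 1)
       := con 2 :* (con 1 :+ j) :* (con 2 :* (con 1 :+ j))) ≡.refl j)
    (ℕₚ.m≤m+n _ (3 ℕ.* (j ℕ.* j) ℕ.+ 5 ℕ.* j ℕ.+ 1))

-- Take `k` with 2 kᵏ ≤ n < 2 (k + 1)ᵏ⁺¹ and as many copies `q` of the grid as fit. Points and lines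
-- together then use at least half of `n`, and each point contributes `k` incidences.
incidences-exist : ∀ n → 2 ℕ.≤ n → ∃[ k ] ∃[ #U ] ∃[ #V ] ∃[ #X ]
  Incidences #U #V #X × #U ℕ.+ #V ℕ.≤ n × n ℕ.* k ℕ.≤ 4 ℕ.* #X ×
  n ℕ.≤ 2 ℕ.^ ((2 ℕ.* k) ℕ.* (2 ℕ.* k))
incidences-exist n 2≤n with crossing (λ k → 2 ℕ.* k ℕ.^ k) n 2≤n n
  (ℕₚ.≤-trans (ℕₚ.m≤m*n (suc n) (suc n ℕ.^ n) {{ℕₚ.m^n≢0 (suc n) n}}) (ℕₚ.m≤m+n _ _))
... | j , 2M≤n , n<f = k , #points k , #lines k , k ℕ.* #points k , gridIncidences k q ,
      fits , many , ℕₚ.≤-trans (ℕₚ.<⇒≤ n<f) (2*[1+k]^[1+k]≤ k)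
  where
  k M q : ℕ
  k = suc j
  M = k ℕ.^ k
  instance
    M≢0 : ℕ.NonZero M
    M≢0 = ℕₚ.m^n≢0 k k
    2M≢0 : ℕ.NonZero (2 ℕ.* M)
    2M≢0 = ℕₚ.m*n≢0 2 M
  q = n DivMod./ (2 ℕ.* M)
  open Incidence k q
  open ℕSolver.+-*-Solver

  -- The dimension equals the side length `k`, so the double count balances.
  #lines≡#points : #lines k ≡ #points k
  #lines≡#points = ℕₚ.*-cancelʳ-≡ _ _ k (≡.trans (#lines*k k) (ℕₚ.*-comm k _))

  twice : #points k ℕ.+ #points k ≡ q ℕ.* (2 ℕ.* M)
  twice = ≡.trans (≡.cong₂ ℕ._+_ (#points≡ k) (#points≡ k))
    (solve 2 (λ q M → q :* M :+ q :* M := q :* (con 2 :* M)) ≡.refl q M)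

  fits : #points k ℕ.+ #lines k ℕ.≤ n
  fits = ≡.subst (ℕ._≤ n) (≡.sym (≡.trans (≡.cong (#points k ℕ.+_) #lines≡#points) twice))
    (DivMod.m/n*n≤m n (2 ℕ.* M))

  many : n ℕ.* k ℕ.≤ 4 ℕ.* (k ℕ.* #points k)
  many = begin
    n ℕ.* k
      ≡⟨ ≡.cong (ℕ._* k) (DivMod.m≡m%n+[m/n]*n n (2 ℕ.* M)) ⟩
    (n DivMod.% (2 ℕ.* M) ℕ.+ q ℕ.* (2 ℕ.* M)) ℕ.* k
      -- The remainder is below 2 M, hence at most q (2 M), because 2 M ≤ n makes `q` positive.
      ≤⟨ ℕₚ.*-monoˡ-≤ k (ℕₚ.+-monoˡ-≤ _ (ℕₚ.≤-trans (ℕₚ.<⇒≤ (DivMod.m%n<n n (2 ℕ.* M)))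
           (ℕₚ.m≤n*m (2 ℕ.* M) q {{ℕ.>-nonZero (DivMod.m≥n⇒m/n>0 2M≤n)}}))) ⟩
    (q ℕ.* (2 ℕ.* M) ℕ.+ q ℕ.* (2 ℕ.* M)) ℕ.* k
      ≡⟨ ≡.cong (λ z → (z ℕ.+ z) ℕ.* k) twice ⟨
    (#points k ℕ.+ #points k ℕ.+ (#points k ℕ.+ #points k)) ℕ.* k
      ≡⟨ solve 2 (λ p k → (p :+ p :+ (p :+ p)) :* k := con 4 :* (k :* p)) ≡.refl (#points k) k ⟩
    4 ℕ.* (k ℕ.* #points k) ∎
    where open ℕₚ.≤-Reasoning

-- A ring solver over the field with integer coefficients.

module FieldSolver (ℝ : CompleteOrderedField) where
  open CompleteOrderedField ℝ
  open CommutativeRing commutativeRing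
    hiding (Carrier; _≈_; _+_; _*_; -_; 0#; 1#; zero)
  open SemiringMult semiring using (×-homo-+; ×1-homo-*; ×-congˡ) renaming (_×_ to _·_)
  open SetoidReasoning setoid
  private
    module S = SemiringSolver commutativeSemiring

    reduce : ℕ × ℕ → ℕ × ℕ
    reduce (suc a , suc b) = reduce (a , b)
    reduce p               = p

    -- (a , b) stands for the integer a - b.  The solver compares normal forms
    -- syntactically, so the operations keep one of the components zero.

    ℤ′ : RawRing 0ℓ 0ℓ
    ℤ′ = record
      { Carrier = ℕ × ℕ
      ; _≈_ = _≡_
      ; _+_ = λ (a , b) (c , d) → reduce (a ℕ.+ c , b ℕ.+ d)
      ; _*_ = λ (a , b) (c , d) → reduce (a ℕ.* c ℕ.+ b ℕ.* d , a ℕ.* d ℕ.+ b ℕ.* c)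
      ; -_  = λ (a , b) → b , a
      ; 0#  = 0 , 0
      ; 1#  = 1 , 0
      }

    diff : ℕ × ℕ → Carrier
    diff (a , b) = a · 1# - b · 1#

    -- The first two clauses let the solver's constants denote 0# and 1# on the nose.

    ⟦_⟧ : ℕ × ℕ → Carrier
    ⟦ 0 , 0 ⟧ = 0#
    ⟦ 1 , 0 ⟧ = 1#
    ⟦ p ⟧     = diff p

    cancel : ∀ x y → (x - y) + y ≈ x
    cancel x y = trans (+-assoc x (- y) y) (trans (+-congˡ (-‿inverseˡ y)) (+-identityʳ x))

    cancel′ : ∀ x y → (x + y) - y ≈ x
    cancel′ x y = trans (+-assoc x y (- y)) (trans (+-congˡ (-‿inverseʳ y)) (+-identityʳ x))

    -- Trades subtraction for addition, so that the homomorphism laws below reduce to identities in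
    -- a commutative semiring.
    diff-unique : ∀ x p → x + proj₂ p · 1# ≈ proj₁ p · 1# → x ≈ diff p
    diff-unique x (a , b) eq = trans (sym (cancel′ x _)) (+-congʳ eq)

    ⟦⟧≈diff : ∀ p → ⟦ p ⟧ ≈ diff p
    ⟦⟧≈diff (0 , 0)           = diff-unique 0# (0 , 0) (+-identityʳ 0#)
    ⟦⟧≈diff (1 , 0)           = diff-unique 1# (1 , 0) refl
    ⟦⟧≈diff (suc (suc _) , 0) = refl
    ⟦⟧≈diff (0 , suc _)       = refl
    ⟦⟧≈diff (1 , suc _)       = refl
    ⟦⟧≈diff (suc (suc _) , suc _) = refl

    diff-reduce : ∀ p → diff (reduce p) ≈ diff p
    diff-reduce (zero  , _)     = refl
    diff-reduce (suc a , zero)  = refl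
    diff-reduce (suc a , suc b) = trans (diff-reduce (a , b)) (diff-unique _ (suc a , suc b)
      (trans (S.solve 3 (λ x o b → x S.:+ (o S.:+ b) S.:= o S.:+ (x S.:+ b)) refl _ 1# _)
        (+-congˡ (cancel _ _))))

    add : ∀ p q → diff (RawRing._+_ ℤ′ p q) ≈ diff p + diff q
    add p@(a , b) q@(c , d) = trans (diff-reduce (a ℕ.+ c , b ℕ.+ d)) (sym (diff-unique _ (a ℕ.+ c , b ℕ.+ d) (begin
      diff p + diff q + (b ℕ.+ d) · 1#          ≈⟨ +-congˡ (×-homo-+ 1# b d) ⟩
      diff p + diff q + (b · 1# + d · 1#)
        ≈⟨ S.solve 4 (λ x y b d → x :+ y :+ (b :+ d) := (x :+ b) :+ (y :+ d)) refl _ _ _ _ ⟩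
      (diff p + b · 1#) + (diff q + d · 1#)     ≈⟨ +-cong (cancel _ _) (cancel _ _) ⟩
      a · 1# + c · 1#                           ≈⟨ ×-homo-+ 1# a c ⟨
      (a ℕ.+ c) · 1# ∎)))
      where
      open S using (_:+_; _:=_)

    ×-homo-dot : ∀ a b c d →
      (a ℕ.* c ℕ.+ b ℕ.* d) · 1# ≈ a · 1# * (c · 1#) + b · 1# * (d · 1#)
    ×-homo-dot a b c d = trans (×-homo-+ 1# (a ℕ.* c) (b ℕ.* d))
      (+-cong (×1-homo-* a c) (×1-homo-* b d))

    mul : ∀ p q → diff (RawRing._*_ ℤ′ p q) ≈ diff p * diff q
    mul p@(a , b) q@(c , d) = trans (diff-reduce r) (sym (diff-unique _ r (begin
      x * y + (a ℕ.* d ℕ.+ b ℕ.* c) · 1#     ≈⟨ +-congˡ (×-homo-dot a b d c) ⟩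
      x * y + (a · 1# * d′ + b′ * (c · 1#))
        ≈⟨ +-congˡ (+-cong (*-congʳ (cancel (a · 1#) b′)) (*-congˡ (cancel (c · 1#) d′))) ⟨
      x * y + ((x + b′) * d′ + b′ * (y + d′))
        ≈⟨ S.solve 4 (λ x y b d → x :* y :+ ((x :+ b) :* d :+ b :* (y :+ d))
             := (x :+ b) :* (y :+ d) :+ b :* d) refl x y b′ d′ ⟩
      (x + b′) * (y + d′) + b′ * d′
        ≈⟨ +-congʳ (*-cong (cancel (a · 1#) b′) (cancel (c · 1#) d′)) ⟩
      a · 1# * (c · 1#) + b′ * d′            ≈⟨ ×-homo-dot a b c d ⟨
      (a ℕ.* c ℕ.+ b ℕ.* d) · 1# ∎)))
      where
      open S using (_:+_; _:*_; _:=_)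
      r = a ℕ.* c ℕ.+ b ℕ.* d , a ℕ.* d ℕ.+ b ℕ.* c
      x = diff p
      y = diff q
      b′ = b · 1#
      d′ = d · 1#

    neg : ∀ p → diff (RawRing.-_ ℤ′ p) ≈ - diff p
    neg p@(a , b) = sym (diff-unique _ (b , a) (begin
      - diff p + a · 1#              ≈⟨ +-congˡ (cancel _ _) ⟨
      - diff p + (diff p + b · 1#)   ≈⟨ +-assoc _ _ _ ⟨
      - diff p + diff p + b · 1#     ≈⟨ +-congʳ (-‿inverseˡ _) ⟩
      0# + b · 1#                    ≈⟨ +-identityˡ _ ⟩
      b · 1# ∎))

    homomorphism : ℤ′ -Raw-AlmostCommutative⟶ fromCommutativeRing commutativeRing
    homomorphism = record
      { ⟦_⟧    = ⟦_⟧
      ; +-homo = λ p q → trans (⟦⟧≈diff (RawRing._+_ ℤ′ p q)) (trans (add p q) (sym (+-cong (⟦⟧≈diff p) (⟦⟧≈diff q))))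
      ; *-homo = λ p q → trans (⟦⟧≈diff (RawRing._*_ ℤ′ p q)) (trans (mul p q) (sym (*-cong (⟦⟧≈diff p) (⟦⟧≈diff q))))
      ; -‿homo = λ p → trans (⟦⟧≈diff (RawRing.-_ ℤ′ p)) (trans (neg p) (-‿cong (sym (⟦⟧≈diff p))))
      ; 0-homo = refl
      ; 1-homo = refl
      }

    _≟_ : ∀ p q → Maybe (⟦ p ⟧ ≈ ⟦ q ⟧)
    p@(a , b) ≟ q@(c , d) with a ℕ.+ d ℕₚ.≟ c ℕ.+ b
    ... | no _   = nothing
    ... | yes eq = just (trans (⟦⟧≈diff p) (trans (diff-unique _ q (begin
      diff p + d · 1#                  ≈⟨ cancel′ _ (b · 1#) ⟨
      diff p + d · 1# + b · 1# - b · 1#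
        ≈⟨ +-congʳ (S.solve 3 (λ x d b → x :+ d :+ b := (x :+ b) :+ d) refl _ _ _) ⟩
      diff p + b · 1# + d · 1# - b · 1# ≈⟨ +-congʳ (+-congʳ (cancel _ _)) ⟩
      a · 1# + d · 1# - b · 1#          ≈⟨ +-congʳ (×-homo-+ 1# a d) ⟨
      (a ℕ.+ d) · 1# - b · 1#           ≈⟨ +-congʳ (×-congˡ {1#} eq) ⟩
      (c ℕ.+ b) · 1# - b · 1#           ≈⟨ +-congʳ (×-homo-+ 1# c b) ⟩
      c · 1# + b · 1# - b · 1#          ≈⟨ cancel′ _ _ ⟩
      c · 1# ∎)) (sym (⟦⟧≈diff q))))
      where
      open S using (_:+_; _:=_)

  open RingSolver ℤ′ (fromCommutativeRing commutativeRing) homomorphism _≟_ public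
    using (solve; _:=_; _:+_; _:*_; _:-_; :-_; con; Polynomial)

  :0 :1 :2 : ∀ {n} → Polynomial n
  :0 = con (0 , 0)
  :1 = con (1 , 0)
  :2 = :1 :+ :1

module LowerBounds (em : ExcludedMiddle 0ℓ) (ℝ : CompleteOrderedField) where
  open CompleteOrderedField ℝ
  open CommutativeRing commutativeRing
    hiding (Carrier; _≈_; _+_; _*_; -_; 0#; 1#; zero)
  open IsTotalOrder isTotalOrder using (total; antisym; ≤-respˡ-≈; ≤-respʳ-≈)
    renaming (refl to ≤-refl; trans to ≤-trans; reflexive to ≤-reflexive)
  open SemiringMult semiring using (×-homo-+; ×1-homo-*; ×-congˡ; ×-assocˡ)
  open OrderedFieldProperties ℝ
  open RealNumbers ℝ
  open ConvexGeometry ℝ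
  open FieldSolver ℝ
  open SetoidReasoning setoid

  -- Arithmetic of the ordered field.

  0≤y-x : ∀ {x y} → x ≤ y → 0# ≤ y - x
  0≤y-x {x} p = ≤-respˡ-≈ (-‿inverseʳ x) (+-monoˡ-≤ (- x) p)

  -- Reduces an inequality to a ring identity: it remains to name a nonnegative expression `e` for
  -- the difference.
  ≤-by : ∀ {x y e} → 0# ≤ e → e ≈ y - x → x ≤ y
  ≤-by {x} {y} 0≤e eq = +-cancelʳ-≤ (- x)
    (≤-respˡ-≈ (sym (-‿inverseʳ x)) (≤-respʳ-≈ eq 0≤e))

  +-nonneg : ∀ {x y} → 0# ≤ x → 0# ≤ y → 0# ≤ x + y
  +-nonneg p q = ≤-respˡ-≈ (+-identityʳ 0#) (+-mono-≤ p q)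

  0≤x*x : ∀ x → 0# ≤ x * x
  0≤x*x x with total 0# x
  ... | inj₁ p = *-nonneg p p
  ... | inj₂ p = ≤-respʳ-≈ (solve 1 (λ x → (:0 :- x) :* (:0 :- x) := x :* x) refl x)
                   (*-nonneg (0≤y-x p) (0≤y-x p))

  x-y≈0⇒x≈y : ∀ {x y} → x - y ≈ 0# → x ≈ y
  x-y≈0⇒x≈y {x} {y} eq = trans (solve 2 (λ x y → x := (x :- y) :+ y) refl x y)
    (trans (+-congʳ eq) (+-identityˡ y))

  x*y≈0⇒y≈0 : ∀ {x y} → ¬ x ≈ 0# → x * y ≈ 0# → y ≈ 0#
  x*y≈0⇒y≈0 {x} {y} x≉0 xy≈0 with i , xi≈1 ← inverse x x≉0 =
    trans (sym (*-identityˡ y)) (trans (*-congʳ (sym xi≈1))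
      (trans (solve 3 (λ x y i → x :* i :* y := i :* (x :* y)) refl x y i)
        (trans (*-congˡ xy≈0) (zeroʳ i))))

  x*x≈0⇒x≈0 : ∀ {x} → x * x ≈ 0# → x ≈ 0#
  x*x≈0⇒x≈0 {x} eq with em {x ≈ 0#}
  ... | yes x≈0 = x≈0
  ... | no x≉0  = x*y≈0⇒y≈0 x≉0 eq

  *-pos : ∀ {x y} → 0# < x → 0# < y → 0# < x * y
  *-pos (0≤x , 0≉x) (0≤y , 0≉y) = *-nonneg 0≤x 0≤y ,
    λ 0≈xy → 0≉y (sym (x*y≈0⇒y≈0 (λ x≈0 → 0≉x (sym x≈0)) (sym 0≈xy)))

  +-pos : ∀ {x y} → 0# ≤ x → 0# < y → 0# < x + y
  +-pos {x} {y} 0≤x (0≤y , 0≉y) = +-nonneg 0≤x 0≤y , λ 0≈x+y →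
    0≉y (antisym 0≤y (≤-respʳ-≈ (sym 0≈x+y) (≤-respˡ-≈ (+-identityˡ y) (+-monoˡ-≤ y 0≤x))))

  0<1 : 0# < 1#
  0<1 = 0≤1 , 0#≉1#

  ≰⇒< : ∀ {x y} → ¬ x ≤ y → y < x
  ≰⇒< {x} {y} x≰y with total x y
  ... | inj₁ x≤y = contradiction x≤y x≰y
  ... | inj₂ y≤x = y≤x , λ y≈x → x≰y (≤-reflexive (sym y≈x))

  <⇒0<y-x : ∀ {x y} → x < y → 0# < y - x
  <⇒0<y-x (x≤y , x≉y) = 0≤y-x x≤y , λ 0≈y-x → x≉y (sym (x-y≈0⇒x≈y (sym 0≈y-x)))

  0<⇒≰0 : ∀ {x} → 0# < x → ¬ x ≤ 0#
  0<⇒≰0 (0≤x , 0≉x) x≤0 = 0≉x (antisym 0≤x x≤0)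

  -- Otherwise x - y is positive, and so is x² - y² = (x - y) (2 y + (x - y)).
  square-cancel-≤ : ∀ {x y} → 0# ≤ y → x * x ≤ y * y → x ≤ y
  square-cancel-≤ {x} {y} 0≤y xx≤yy with em {x ≤ y}
  ... | yes x≤y = x≤y
  ... | no x≰y  = contradiction
    (≤-by (0≤y-x xx≤yy) (solve 2 (λ x y → y :* y :- x :* x
      := :0 :- ((x :- y) :* (y :+ y :+ (x :- y)))) refl x y))
    (0<⇒≰0 (*-pos 0<x-y (+-pos (+-nonneg 0≤y 0≤y) 0<x-y)))
    where
    0<x-y : 0# < x - y
    0<x-y = <⇒0<y-x (≰⇒< x≰y)

  square-injective : ∀ {x y} → 0# ≤ x → 0# ≤ y → x * x ≈ y * y → x ≈ y
  square-injective 0≤x 0≤y eq = antisym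
    (square-cancel-≤ 0≤y (≤-reflexive eq))
    (square-cancel-≤ 0≤x (≤-reflexive (sym eq)))

  *-monoˡ-≤ : ∀ {x y} z → 0# ≤ z → x ≤ y → z * x ≤ z * y
  *-monoˡ-≤ {x} {y} z 0≤z x≤y = ≤-by (*-nonneg 0≤z (0≤y-x x≤y))
    (solve 3 (λ x y z → z :* (y :- x) := z :* y :- z :* x) refl x y z)

  -- The inverse equals x i², a product of nonnegative factors.
  inverse-pos : ∀ {x i} → 0# < x → x * i ≈ 1# → 0# < i
  inverse-pos {x} {i} (0≤x , 0≉x) xi≈1 =
    ≤-respʳ-≈ (trans (solve 2 (λ x i → x :* (i :* i) := x :* i :* i) refl x i)
                (trans (*-congʳ xi≈1) (*-identityˡ i)))
      (*-nonneg 0≤x (0≤x*x i)) ,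
    λ 0≈i → 0#≉1# (trans (sym (zeroʳ x)) (trans (*-congˡ 0≈i) xi≈1))

  -- Square roots and absolute values.

  √-nonneg : ∀ x → 0# ≤ √ x
  √-nonneg x = proj₁ (proj₂ (√-supremum x)) 0# (inj₁ refl)

  -- With M = 1 + x, so that x ≤ M², the map  s ↦ (s M + x) / (s + M)  moves every
  -- s ≥ 0 towards √ x without crossing it, which refutes both s² < x and x < s².

  √-square : ∀ {x} → 0# ≤ x → √ x * √ x ≈ x
  √-square {x} 0≤x = antisym s²≤x x≤s²
    where
    s M z : Carrier
    s = √ x
    M = 1# + x
    z = s + M

    0<z : 0# < z
    0<z = ≤-respʳ′ (+-pos (+-nonneg (√-nonneg x) 0≤x) 0<1)
      where
      eq : (s + x) + 1# ≈ z
      eq = solve 2 (λ s x → (s :+ x) :+ :1 := s :+ (:1 :+ x)) refl s x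
      ≤-respʳ′ : 0# < (s + x) + 1# → 0# < z
      ≤-respʳ′ (p , q) = ≤-respʳ-≈ eq p , λ r → q (trans r (sym eq))

    i y : Carrier
    i = proj₁ (inverse z (λ z≈0 → proj₂ 0<z (sym z≈0)))
    y = (s * M + x) * i

    zi≈1 : z * i ≈ 1#
    zi≈1 = proj₂ (inverse z (λ z≈0 → proj₂ 0<z (sym z≈0)))

    0≤i : 0# ≤ i
    0≤i = proj₁ (inverse-pos 0<z zi≈1)

    0≤M²-x : 0# ≤ M * M - x
    0≤M²-x = ≤-respʳ-≈ (solve 1 (λ x → :1 :+ (x :+ x :* x) := (:1 :+ x) :* (:1 :+ x) :- x) refl x)
      (+-nonneg 0≤1 (+-nonneg 0≤x (0≤x*x x)))

    y*y-x : y * y - x ≈ (s * s - x) * ((M * M - x) * (i * i))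
    y*y-x = begin
      y * y - x                           ≈⟨ +-congˡ (-‿cong (*-identityʳ x)) ⟨
      y * y - x * 1#                      ≈⟨ +-congˡ (-‿cong (*-congˡ (*-identityʳ 1#))) ⟨
      y * y - x * (1# * 1#)               ≈⟨ +-congˡ (-‿cong (*-congˡ (*-cong zi≈1 zi≈1))) ⟨
      -- Writing 1 as (z i)² brings `x` to the common denominator; the identity then shows that y²
      -- lies on the same side of `x` as s².
      y * y - x * ((z * i) * (z * i))
        ≈⟨ solve 4 (λ s m x i → (s :* m :+ x) :* i :* ((s :* m :+ x) :* i)
              :- x :* ((s :+ m) :* i :* ((s :+ m) :* i))
            := (s :* s :- x) :* ((m :* m :- x) :* (i :* i))) refl s M x i ⟩
      (s * s - x) * ((M * M - x) * (i * i)) ∎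

    0≤factor : 0# ≤ (M * M - x) * (i * i)
    0≤factor = *-nonneg 0≤M²-x (0≤x*x i)

    y*z : y * z ≈ s * M + x
    y*z = trans (*-assoc _ i z) (trans (*-congˡ (trans (*-comm i z) zi≈1)) (*-identityʳ _))

    0≤y : 0# ≤ y
    0≤y = *-nonneg (+-nonneg (*-nonneg (√-nonneg x) (+-nonneg 0≤1 0≤x)) 0≤x) 0≤i

    x≤s² : x ≤ s * s
    x≤s² with total (s * s) x
    ... | inj₂ p = p
    -- Here y² ≤ x, so `y` belongs to the set with supremum `s`; and z (s - y) = s² - x.
    ... | inj₁ p = ≤-by (0≤y-x (*-monoˡ-≤ z (proj₁ 0<z) y≤s)) (begin
      z * s - z * y         ≈⟨ +-congˡ (-‿cong (trans (*-comm z y) y*z)) ⟩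
      z * s - (s * M + x)   ≈⟨ solve 3 (λ s m x → (s :+ m) :* s :- (s :* m :+ x) := s :* s :- x)
                                 refl s M x ⟩
      s * s - x ∎)
      where
      y≤s : y ≤ s
      y≤s = proj₁ (proj₂ (√-supremum x)) y (inj₂ (≤-by (*-nonneg (0≤y-x p) 0≤factor) (begin
        (x - s * s) * ((M * M - x) * (i * i))
          ≈⟨ solve 3 (λ a b c → (a :- b) :* c := :- ((b :- a) :* c)) refl x (s * s) _ ⟩
        - ((s * s - x) * ((M * M - x) * (i * i)))  ≈⟨ -‿cong y*y-x ⟨
        - (y * y - x)                              ≈⟨ solve 2 (λ a b → :- (a :- b) := b :- a)
                                                        refl (y * y) x ⟩
        x - y * y ∎)))

    s²≤x : s * s ≤ x
    s²≤x with total x (s * s)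
    ... | inj₂ p = p
    -- Here x ≤ y², so `y` is an upper bound of the set with supremum `s`.
    ... | inj₁ p = ≤-by (0≤y-x (*-monoˡ-≤ z (proj₁ 0<z) s≤y)) (begin
      z * y - z * s         ≈⟨ +-congʳ (trans (*-comm z y) y*z) ⟩
      s * M + x - z * s     ≈⟨ solve 3 (λ s m x → s :* m :+ x :- (s :+ m) :* s := x :- s :* s)
                                 refl s M x ⟩
      x - s * s ∎)
      where
      x≤y² : x ≤ y * y
      x≤y² = ≤-by (*-nonneg (0≤y-x p) 0≤factor) (sym y*y-x)
      s≤y : s ≤ y
      s≤y = proj₂ (proj₂ (√-supremum x)) y λ
        { t (inj₁ t≈0)  → ≤-respˡ-≈ (sym t≈0) 0≤y
        ; t (inj₂ tt≤x) → square-cancel-≤ 0≤y (≤-trans tt≤x x≤y²) }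

  √-unique : ∀ {x y} → 0# ≤ y → y * y ≈ x → √ x ≈ y
  √-unique {x} {y} 0≤y eq = square-injective (√-nonneg x) 0≤y
    (trans (√-square (≤-respʳ-≈ eq (0≤x*x y))) (sym eq))

  √-≤ : ∀ {x y} → 0# ≤ y → x ≤ y * y → √ x ≤ y
  √-≤ {x} {y} 0≤y x≤yy = proj₂ (proj₂ (√-supremum x)) y λ
    { t (inj₁ t≈0)  → ≤-respˡ-≈ (sym t≈0) 0≤y
    ; t (inj₂ tt≤x) → square-cancel-≤ 0≤y (≤-trans tt≤x x≤yy) }

  ∣∣-nonneg : ∀ x → 0# ≤ ∣ x ∣
  ∣∣-nonneg x with total 0# x
  ... | inj₁ p = p
  ... | inj₂ p = ≤-respʳ-≈ (+-identityˡ (- x)) (0≤y-x p)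

  ∣∣-square : ∀ x → ∣ x ∣ * ∣ x ∣ ≈ x * x
  ∣∣-square x with total 0# x
  ... | inj₁ p = refl
  ... | inj₂ p = solve 1 (λ x → :- x :* :- x := x :* x) refl x

  -- Sign and square determine the absolute value, so that the laws below need no cases on signs.
  ∣∣-unique : ∀ {x y} → 0# ≤ y → y * y ≈ x * x → ∣ x ∣ ≈ y
  ∣∣-unique {x} 0≤y eq = square-injective (∣∣-nonneg x) 0≤y (trans (∣∣-square x) (sym eq))

  ∣∣-cong : ∀ {x y} → x ≈ y → ∣ x ∣ ≈ ∣ y ∣
  ∣∣-cong {x} {y} x≈y = ∣∣-unique (∣∣-nonneg y)
    (trans (∣∣-square y) (*-cong (sym x≈y) (sym x≈y)))

  ∣∣-* : ∀ x y → ∣ x * y ∣ ≈ ∣ x ∣ * ∣ y ∣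
  ∣∣-* x y = ∣∣-unique (*-nonneg (∣∣-nonneg x) (∣∣-nonneg y))
    (trans (interchange _ _ _ _) (trans (*-cong (∣∣-square x) (∣∣-square y)) (interchange _ _ _ _)))
    where
    interchange : ∀ a b c d → a * b * (c * d) ≈ a * c * (b * d)
    interchange = solve 4 (λ a b c d → a :* b :* (c :* d) := a :* c :* (b :* d)) refl

  x≤∣x∣ : ∀ x → x ≤ ∣ x ∣
  x≤∣x∣ x = square-cancel-≤ (∣∣-nonneg x) (≤-reflexive (sym (∣∣-square x)))

  ∣∣-triangle : ∀ x y → ∣ x + y ∣ ≤ ∣ x ∣ + ∣ y ∣
  ∣∣-triangle x y = square-cancel-≤ (+-nonneg (∣∣-nonneg x) (∣∣-nonneg y))
    (≤-by (+-nonneg 0≤d 0≤d) (begin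
      (a * b - x * y) + (a * b - x * y)
        ≈⟨ solve 4 (λ x y a b → (a :* b :- x :* y) :+ (a :* b :- x :* y)
             := (a :+ b) :* (a :+ b) :- (a :* a :+ b :* b :+ (x :* y :+ x :* y))) refl x y a b ⟩
      (a + b) * (a + b) - (a * a + b * b + (x * y + x * y))
        ≈⟨ +-congˡ (-‿cong (+-congʳ (+-cong (∣∣-square x) (∣∣-square y)))) ⟩
      (a + b) * (a + b) - (x * x + y * y + (x * y + x * y))
        ≈⟨ +-congˡ (-‿cong (solve 2 (λ x y → x :* x :+ y :* y :+ (x :* y :+ x :* y)
             := (x :+ y) :* (x :+ y)) refl x y)) ⟩
      (a + b) * (a + b) - (x + y) * (x + y)
        ≈⟨ +-congˡ (-‿cong (∣∣-square (x + y))) ⟨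
      (a + b) * (a + b) - ∣ x + y ∣ * ∣ x + y ∣ ∎))
    where
    a = ∣ x ∣
    b = ∣ y ∣
    0≤d : 0# ≤ a * b - x * y
    0≤d = 0≤y-x (≤-respʳ-≈ (∣∣-* x y) (x≤∣x∣ (x * y)))

  -- Convex independence on a parabola.

  ⟨_,_⟩ : Carrier → Carrier → Point 2
  ⟨ x , y ⟩ 0F = x
  ⟨ x , y ⟩ 1F = y

  ≋-coordinates : ∀ {p q : Point 2} → p 0F ≈ q 0F → p 1F ≈ q 1F → p ≋ q
  ≋-coordinates p q 0F = p
  ≋-coordinates p q 1F = q

  sum-nonneg : ∀ {m} (f : Vector Carrier m) → (∀ i → 0# ≤ f i) → 0# ≤ sum f
  sum-nonneg {zero}  f 0≤f = ≤-refl
  sum-nonneg {suc m} f 0≤f = +-nonneg (0≤f Fin.zero) (sum-nonneg (f ∘ Fin.suc) (0≤f ∘ Fin.suc))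

  x+y≈0⇒y≈0 : ∀ {x y} → 0# ≤ x → 0# ≤ y → x + y ≈ 0# → y ≈ 0#
  x+y≈0⇒y≈0 {x} {y} 0≤x 0≤y eq =
    antisym (≤-respʳ-≈ eq (≤-respˡ-≈ (+-identityˡ y) (+-monoˡ-≤ y 0≤x))) 0≤y

  x+y≈0⇒x≈0 : ∀ {x y} → 0# ≤ x → 0# ≤ y → x + y ≈ 0# → x ≈ 0#
  x+y≈0⇒x≈0 {x} {y} 0≤x 0≤y eq = x+y≈0⇒y≈0 0≤y 0≤x (trans (+-comm y x) eq)

  -- Nonnegative terms with sum zero all vanish, and each factor `h i` can be cancelled.
  weights-vanish : ∀ {m} (w h : Vector Carrier m) → (∀ i → 0# ≤ w i) → (∀ i → 0# < h i) →
                   sum (λ i → w i * h i) ≈ 0# → sum w ≈ 0#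
  weights-vanish {zero}  w h 0≤w 0<h eq = refl
  weights-vanish {suc m} w h 0≤w 0<h eq = trans (+-cong
      (x*y≈0⇒y≈0 (λ h≈0 → proj₂ (0<h Fin.zero) (sym h≈0))
        (trans (*-comm _ _) (x+y≈0⇒x≈0 (0≤wh Fin.zero) 0≤rest eq)))
      (weights-vanish (w ∘ Fin.suc) (h ∘ Fin.suc) (0≤w ∘ Fin.suc) (0<h ∘ Fin.suc)
        (x+y≈0⇒y≈0 (0≤wh Fin.zero) 0≤rest eq)))
    (+-identityʳ 0#)
    where
    0≤wh : ∀ i → 0# ≤ w i * h i
    0≤wh i = *-nonneg (0≤w i) (proj₁ (0<h i))
    0≤rest : 0# ≤ sum (λ i → w (Fin.suc i) * h (Fin.suc i))
    0≤rest = sum-nonneg _ (0≤wh ∘ Fin.suc)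

  -- Evaluates an affine functional at a weighted combination of points.
  sum-affine : ∀ {m} (w u v : Vector Carrier m) b c →
    sum (λ i → w i * (u i + b * v i + c)) ≈
    sum (λ i → w i * u i) + b * sum (λ i → w i * v i) + c * sum w
  sum-affine {zero}  w u v b c = solve 2 (λ b c → :0 := :0 :+ b :* :0 :+ c :* :0) refl b c
  sum-affine {suc m} w u v b c = trans
    (+-congˡ (sum-affine (w ∘ Fin.suc) (u ∘ Fin.suc) (v ∘ Fin.suc) b c))
    (solve 8 (λ w u v b c s t r →
        w :* (u :+ b :* v :+ c) :+ (s :+ b :* t :+ c :* r)
          := w :* u :+ s :+ b :* (w :* v :+ t) :+ c :* (w :+ r)) refl
      (w Fin.zero) (u Fin.zero) (v Fin.zero) b c _ _ _)

  -- The tangent line at x is a supporting line: g (u - x₀)² is the height of the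
  -- parabola above it, so a convex combination representing x has no weight.

  parabola-convexlyIndependent : ∀ {n} (C : PointSet 2 n) g → 0# < g →
    (∀ a → point C a 1F ≈ g * (point C a 0F * point C a 0F)) →
    ConvexlyIndependent (elements C)
  parabola-convexlyIndependent C g 0<g onC x x∈C (m , w , y , 0≤w , Σw≈1 , y∈ , x≋) =
    0#≉1# (trans (sym (weights-vanish w h 0≤w 0<h Σwh≈0)) Σw≈1)
    where
    on : ∀ {z} → z ∈ elements C → z 1F ≈ g * (z 0F * z 0F)
    on (a , z≋) = trans (z≋ 1F) (trans (onC a) (*-congˡ (*-cong (sym (z≋ 0F)) (sym (z≋ 0F)))))

    b : Carrier
    b = - (g * x 0F + g * x 0F)

    h : Vector Carrier m
    h i = y i 1F + b * y i 0F + g * (x 0F * x 0F)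

    h≈ : ∀ i → h i ≈ g * ((y i 0F - x 0F) * (y i 0F - x 0F))
    h≈ i = trans (+-congʳ (+-congʳ (on (proj₁ (y∈ i)))))
      (solve 3 (λ g x y → g :* (y :* y) :+ :- (g :* x :+ g :* x) :* y :+ g :* (x :* x)
        := g :* ((y :- x) :* (y :- x))) refl g (x 0F) (y i 0F))

    0<h : ∀ i → 0# < h i
    0<h i = ≤-respʳ-≈ (sym (h≈ i)) (*-nonneg (proj₁ 0<g) (0≤x*x _)) , λ 0≈h →
      -- Height zero forces equal abscissas, hence equal points of the parabola, although `x` itself
      -- was removed from the set.
      let y₀≈x₀ = x-y≈0⇒x≈y (x*x≈0⇒x≈0 (x*y≈0⇒y≈0 (λ g≈0 → proj₂ 0<g (sym g≈0))
                    (trans (sym (h≈ i)) (sym 0≈h))))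
      in proj₂ (y∈ i) (≋-coordinates y₀≈x₀ (trans (on (proj₁ (y∈ i)))
           (trans (*-congˡ (*-cong y₀≈x₀ y₀≈x₀)) (sym (on x∈C)))))

    Σwh≈0 : sum (λ i → w i * h i) ≈ 0#
    Σwh≈0 = begin
      sum (λ i → w i * h i)
        ≈⟨ sum-affine w (λ i → y i 1F) (λ i → y i 0F) b (g * (x 0F * x 0F)) ⟩
      sum (λ i → w i * y i 1F) + b * sum (λ i → w i * y i 0F) + g * (x 0F * x 0F) * sum w
        ≈⟨ +-cong (+-cong (sym (x≋ 1F)) (*-congˡ (sym (x≋ 0F)))) (*-congˡ Σw≈1) ⟩
      x 1F + b * x 0F + g * (x 0F * x 0F) * 1#
        ≈⟨ +-congʳ (+-congʳ (on x∈C)) ⟩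
      g * (x 0F * x 0F) + b * x 0F + g * (x 0F * x 0F) * 1#
        ≈⟨ solve 2 (λ g x → g :* (x :* x) :+ :- (g :* x :+ g :* x) :* x :+ g :* (x :* x) :* :1 := :0)
             refl g (x 0F) ⟩
      0# ∎

  -- Completing finite families to point sets of prescribed size.

  bounded : ∀ {n} (f : Fin n → Carrier) → ∃[ b ] 0# < b × (∀ i → f i < b)
  bounded {zero}  f = 1# , 0<1 , λ ()
  bounded {suc n} f with b , 0<b , f<b ← bounded (f ∘ Fin.suc) =
    c , +-pos′ , λ { Fin.zero → f₀<c ; (Fin.suc i) → ≤-trans (proj₁ (f<b i)) b≤c ,
      λ f≈c → proj₂ (f<b i) (antisym (proj₁ (f<b i)) (≤-respʳ-≈ (sym f≈c) b≤c)) }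
    where
    a c : Carrier
    a = ∣ f Fin.zero ∣
    c = a + b
    +-pos′ : 0# < c
    +-pos′ = +-pos (∣∣-nonneg _) 0<b
    b≤c : b ≤ c
    b≤c = ≤-respˡ-≈ (+-identityˡ b) (+-monoˡ-≤ b (∣∣-nonneg _))
    f₀<c : f Fin.zero < c
    f₀<c = ≤-trans (x≤∣x∣ _) (≤-respˡ-≈ (+-identityʳ a) (+-monoʳ-≤ a (proj₁ 0<b))) ,
      λ f≈c → 0<⇒≰0 0<b (+-cancelʳ-≤ a (≤-respˡ-≈ (trans f≈c (+-comm a b))
        (≤-respʳ-≈ (sym (+-identityˡ a)) (x≤∣x∣ _))))

  adjoin : ∀ {d n} (P : PointSet d n) (x : Point d) → ¬ x ∈ elements P → PointSet d (suc n)
  adjoin P x x∉P = record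
    { point    = λ { Fin.zero → x ; (Fin.suc i) → point P i }
    ; distinct = λ
      { {Fin.zero}  {Fin.zero}  _  → ≡.refl
      ; {Fin.zero}  {Fin.suc j} eq → contradiction (j , eq) x∉P
      ; {Fin.suc i} {Fin.zero}  eq → contradiction (i , λ t → sym (eq t)) x∉P
      ; {Fin.suc i} {Fin.suc j} eq → ≡.cong Fin.suc (distinct P eq)
      }
    }

  -- A point to the right of all the others is new.
  extend : ∀ {n} (P : PointSet 2 n) → Σ[ Q ∈ PointSet 2 (suc n) ] elements P ⊆ elements Q
  extend P with b , _ , P<b ← bounded (λ i → point P i 0F) =
    adjoin P ⟨ b , 0# ⟩ (λ (i , b≋) → proj₂ (P<b i) (sym (b≋ 0F))) , λ (i , eq) → Fin.suc i , eq

  pad : ∀ {m n} → m ℕ.≤′ n → (P : PointSet 2 m) → Σ[ Q ∈ PointSet 2 n ] elements P ⊆ elements Q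
  pad ℕ.≤′-refl       P = P , λ x∈P → x∈P
  pad (ℕ.≤′-step m≤n) P with Q , P⊆Q ← pad m≤n P with R , Q⊆R ← extend Q = R , Q⊆R ∘ P⊆Q

  collect : ∀ {m} (f : Fin m → Point 2) → Σ[ P ∈ PointSet 2 m ] (∀ i → f i ∈ elements P)
  collect {zero}  f = record { point = λ () ; distinct = λ { {()} } } , λ ()
  collect {suc m} f with P , f∈P ← collect (f ∘ Fin.suc) with em {f Fin.zero ∈ elements P}
  ... | no f₀∉P = adjoin P (f Fin.zero) f₀∉P , λ
    { Fin.zero → Fin.zero , λ _ → refl ; (Fin.suc i) → let (j , eq) = f∈P i in Fin.suc j , eq }
  -- A repeated value is replaced by a fresh point, which keeps the size equal to `suc m`.
  ... | yes f₀∈P with Q , P⊆Q ← extend P =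
    Q , λ { Fin.zero → P⊆Q f₀∈P ; (Fin.suc i) → P⊆Q (f∈P i) }

  cover : ∀ {m n} → m ℕ.≤ n → (f : Fin m → Point 2) →
          Σ[ P ∈ PointSet 2 n ] (∀ i → f i ∈ elements P)
  cover m≤n f with P , f∈P ← collect f with Q , P⊆Q ← pad (ℕₚ.≤⇒≤′ m≤n) P = Q , P⊆Q ∘ f∈P

  cover₂ : ∀ {l m n} → l ℕ.+ m ℕ.≤ n → (f : Fin l → Point 2) (g : Fin m → Point 2) →
    Σ[ P ∈ PointSet 2 n ] (∀ i → f i ∈ elements P) × (∀ j → g j ∈ elements P)
  cover₂ {l} {m} l+m≤n f g with P , fg∈P ← cover l+m≤n ([ f , g ]′ ∘ Fin.splitAt l) =
    P , (λ i → ≡.subst (λ s → [ f , g ]′ s ∈ elements P) (Finₚ.splitAt-↑ˡ l i m) (fg∈P (i Fin.↑ˡ m)))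
      , (λ j → ≡.subst (λ s → [ f , g ]′ s ∈ elements P) (Finₚ.splitAt-↑ʳ l m j) (fg∈P (l Fin.↑ʳ j)))

  -- Index pairs are increasing, so either of the two points may come first; both orders have to be
  -- allowed.
  pairOf : ∀ {d n} (P : PointSet d n) {x y} → x ∈ elements P → y ∈ elements P → ¬ x ≋ y →
    Σ[ (i , j , _) ∈ IndexPair n ]
      ((x ≋ point P i × y ≋ point P j) ⊎ (x ≋ point P j × y ≋ point P i))
  pairOf P (i , x≋) (j , y≋) x≉y with Finₚ.<-cmp i j
  ... | tri< i<j _ _ = (i , j , i<j) , inj₁ (x≋ , y≋)
  ... | tri≈ _ ≡.refl _ = contradiction (λ t → trans (x≋ t) (sym (y≋ t))) x≉y
  ... | tri> _ _ j<i = (j , i , j<i) , inj₂ (x≋ , y≋)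

  -- Existence of the extremal numbers.

  maximum : ∀ (S : Pred ℕ 0ℓ) {k} b → k ∈ S → (∀ m → m ∈ S → m ℕ.≤ b) →
            ∃[ m ] IsMaximum ℕ._≤_ S m × k ℕ.≤ m
  -- Excluded middle decides whether the bound is attained. If not, it drops by one, and it never
  -- drops below the known element.
  maximum S b k∈S S≤b with em {b ∈ S}
  ... | yes b∈S = b , (b∈S , S≤b) , S≤b _ k∈S
  maximum S zero    k∈S S≤b | no b∉S =
    contradiction (≡.subst S (ℕₚ.n≤0⇒n≡0 (S≤b _ k∈S)) k∈S) b∉S
  maximum S (suc b) k∈S S≤b | no b∉S = maximum S b k∈S λ m m∈S →
    ℕ.s≤s⁻¹ (ℕₚ.≤∧≢⇒< (S≤b m m∈S) λ { ≡.refl → b∉S m∈S })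

  -- Gives the crude upper bounds from which all three maxima exist: every counted object is
  -- determined by two indices.
  pair-injection⇒≤ : ∀ {k m n} (f : Fin k → Fin m) (g : Fin k → Fin n) →
    (∀ a b → f a ≡ f b → g a ≡ g b → a ≡ b) → k ℕ.≤ m ℕ.* n
  pair-injection⇒≤ f g inj = Finₚ.injective⇒≤ {f = λ a → combine (f a) (g a)} λ {a} {b} eq →
    let (f≡ , g≡) = Finₚ.combine-injective (f a) (g a) (f b) (g b) eq in inj a b f≡ g≡

  selectablePairs≤ : ∀ {d n} (P : PointSet d n) k → k ∈ SelectablePairs P → k ℕ.≤ n ℕ.* n
  selectablePairs≤ P k (e , C , C≋ , _) =
    pair-injection⇒≤ (proj₁ ∘ e) (proj₁ ∘ proj₂ ∘ e) λ a b i≡ j≡ → distinct C λ t →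
      trans (C≋ a t) (trans (reflexive (≡.cong₂ (λ i j → midpoint (point P i) (point P j) t) i≡ j≡))
        (sym (C≋ b t)))

  -- The maximum is nested: first over the selections in a fixed set, then over the sets.
  E-maximum : ∀ {n k} (P : PointSet 2 n) → k ∈ SelectablePairs P → ∃[ e ] IsE 2 n e × k ℕ.≤ e
  E-maximum {n} P k∈ with e , P-max , k≤e ← maximum _ (n ℕ.* n) k∈ (selectablePairs≤ P)
    with m , m-max , e≤m ← maximum (λ k → Σ[ P ∈ PointSet 2 n ] IsEOf P k) (n ℕ.* n) (P , P-max)
           (λ m (Q , m∈ , _) → selectablePairs≤ Q m m∈)
    = m , m-max , ℕₚ.≤-trans k≤e e≤m

  M-maximum : ∀ {n k} (P Q : PointSet 2 n) (C : PointSet 2 k) →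
    elements C ⊆ (elements P ⊕ elements Q) → ConvexlyIndependent (elements C) →
    ∃[ m ] IsM 2 n n m × k ℕ.≤ m
  M-maximum {n} P Q C C⊆ ind = maximum _ (n ℕ.* n) (P , Q , C , (λ {x} → C⊆ {x}) , ind)
    λ m (P , Q , C , C⊆ , _) →
      let sum-of = λ a → C⊆ {point C a} (a , λ _ → refl)
          i = λ a → proj₁ (proj₁ (proj₂ (proj₂ (sum-of a))))
          j = λ a → proj₁ (proj₁ (proj₂ (proj₂ (proj₂ (sum-of a)))))
          C≋ : ∀ a t → point C a t ≈ point P (i a) t + point Q (j a) t
          C≋ a t = let (_ , _ , (_ , p≋) , (_ , q≋) , c≋) = sum-of a in
            trans (c≋ t) (+-cong (p≋ t) (q≋ t))
      in pair-injection⇒≤ i j λ a b i≡ j≡ → distinct C λ t →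
           trans (C≋ a t) (trans
             (reflexive (≡.cong₂ (λ i j → point P i t + point Q j t) i≡ j≡)) (sym (C≋ b t)))

  W-maximum : ∀ {n k} (N : Norm 2) → StrictlyConvex N → (P : PointSet 2 n) →
    (e : Fin k → IndexPair n) → (∀ a → Norm.‖_‖ N (difference P (e a)) ≈ 1#) →
    (∀ a b → a ≢ b → ¬ Parallel (difference P (e a)) (difference P (e b))) →
    ∃[ w ] IsW 2 n w × k ℕ.≤ w
  W-maximum {n} N sc P e unit npar = maximum _ (n ℕ.* n) (N , sc , P , e , unit , npar)
    λ m (_ , _ , P , e , _ , npar) →
      pair-injection⇒≤ (proj₁ ∘ e) (proj₁ ∘ proj₂ ∘ e) λ a b i≡ j≡ →
        case em {a ≡ b} of λ
          { (yes a≡b) → a≡b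
          -- Two segments with the same index pair are parallel with factor 1.
          ; (no a≢b)  → contradiction (1# , λ t → trans
              (reflexive (≡.cong₂ (λ i j → point P i t - point P j t) i≡ j≡))
              (sym (*-identityˡ _))) (npar a b a≢b) }

  -- A strictly convex norm with a ball bounded by parabolas.

  2# : Carrier
  2# = 1# + 1#

  0<2 : 0# < 2#
  0<2 = +-pos 0≤1 0<1

  2*½ : 2# * ½ ≈ 1#
  2*½ = proj₂ (inverse (1# + 1#) 2≉0)

  -- The unit ball is |y| ≤ B − x², bounded by two parabolic arcs: solving
  -- |y| / t + x² / t² = B for t gives t = (|y| + √ (y² + 4 B x²)) / 2 B.

  module _ (B : Carrier) (0<B : 0# < B) where

    private
      0<2B : 0# < 2# * B
      0<2B = *-pos 0<2 0<B

      2B≉0 : ¬ 2# * B ≈ 0#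
      2B≉0 eq = proj₂ 0<2B (sym eq)

      s A : Carrier
      s = proj₁ (inverse (2# * B) 2B≉0)
      A = 2# * (2# * B)

      2B*s : 2# * B * s ≈ 1#
      2B*s = proj₂ (inverse (2# * B) 2B≉0)

      0<s : 0# < s
      0<s = inverse-pos 0<2B 2B*s

      0<A : 0# < A
      0<A = *-pos 0<2 0<2B

      Q : Point 2 → Carrier
      Q p = p 1F * p 1F + A * (p 0F * p 0F)

      0≤Q : ∀ p → 0# ≤ Q p
      0≤Q p = +-nonneg (0≤x*x _) (*-nonneg (proj₁ 0<A) (0≤x*x _))

      h : Point 2 → Carrier
      h p = √ (Q p)

      h² : ∀ p → h p * h p ≈ Q p
      h² p = √-square (0≤Q p)

      0≤h : ∀ p → 0# ≤ h p
      0≤h p = √-nonneg (Q p)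

      polar : Point 2 → Point 2 → Carrier
      polar p q = p 1F * q 1F + A * (p 0F * q 0F)

      -- Lagrange's identity: the squares of the two sides differ by `A` times the square of the
      -- determinant of `p` and `q`.
      cauchy-schwarz : ∀ p q → polar p q ≤ h p * h q
      cauchy-schwarz p q = square-cancel-≤ (*-nonneg (0≤h p) (0≤h q))
        (≤-by (*-nonneg (proj₁ 0<A) (0≤x*x (p 0F * q 1F - q 0F * p 1F))) (begin
          A * ((p 0F * q 1F - q 0F * p 1F) * (p 0F * q 1F - q 0F * p 1F))
            ≈⟨ solve 5 (λ a x y u v → a :* ((x :* v :- u :* y) :* (x :* v :- u :* y))
                 := (y :* y :+ a :* (x :* x)) :* (v :* v :+ a :* (u :* u))
                    :- (y :* v :+ a :* (x :* u)) :* (y :* v :+ a :* (x :* u)))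
                 refl A (p 0F) (p 1F) (q 0F) (q 1F) ⟩
          Q p * Q q - polar p q * polar p q
            ≈⟨ +-congʳ (*-cong (h² p) (h² q)) ⟨
          (h p * h p) * (h q * h q) - polar p q * polar p q
            ≈⟨ +-congʳ (solve 2 (λ a b → a :* a :* (b :* b) := a :* b :* (a :* b)) refl (h p) (h q)) ⟩
          h p * h q * (h p * h q) - polar p q * polar p q ∎))

      h-triangle : ∀ p q → h (p +ᵥ q) ≤ h p + h q
      h-triangle p q = square-cancel-≤ (+-nonneg (0≤h p) (0≤h q))
        (≤-by (*-nonneg (proj₁ 0<2) (0≤y-x (cauchy-schwarz p q))) (begin
          2# * (h p * h q - polar p q)
            ≈⟨ solve 3 (λ a b c → :2 :* (a :* b :- c)
                 := (a :+ b) :* (a :+ b) :- (a :* a :+ b :* b :+ :2 :* c)) refl (h p) (h q) (polar p q) ⟩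
          (h p + h q) * (h p + h q) - (h p * h p + h q * h q + 2# * polar p q)
            ≈⟨ +-congˡ (-‿cong (+-congʳ (+-cong (h² p) (h² q)))) ⟩
          (h p + h q) * (h p + h q) - (Q p + Q q + 2# * polar p q)
            ≈⟨ +-congˡ (-‿cong (solve 5 (λ a x y u v →
                  y :* y :+ a :* (x :* x) :+ (v :* v :+ a :* (u :* u)) :+ :2 :* (y :* v :+ a :* (x :* u))
                  := (y :+ v) :* (y :+ v) :+ a :* ((x :+ u) :* (x :+ u)))
                refl A (p 0F) (p 1F) (q 0F) (q 1F))) ⟩
          (h p + h q) * (h p + h q) - Q (p +ᵥ q)
            ≈⟨ +-congˡ (-‿cong (h² (p +ᵥ q))) ⟨
          (h p + h q) * (h p + h q) - h (p +ᵥ q) * h (p +ᵥ q) ∎))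

      h-homogeneous : ∀ t p → h (t *ᵥ p) ≈ ∣ t ∣ * h p
      h-homogeneous t p = √-unique (*-nonneg (∣∣-nonneg t) (0≤h p)) (begin
        ∣ t ∣ * h p * (∣ t ∣ * h p)     ≈⟨ solve 2 (λ a b → a :* b :* (a :* b) := a :* a :* (b :* b))
                                            refl ∣ t ∣ (h p) ⟩
        ∣ t ∣ * ∣ t ∣ * (h p * h p)     ≈⟨ *-cong (∣∣-square t) (h² p) ⟩
        t * t * Q p                     ≈⟨ solve 4 (λ t a x y → t :* t :* (y :* y :+ a :* (x :* x))
                                            := t :* y :* (t :* y) :+ a :* (t :* x :* (t :* x)))
                                            refl t A (p 0F) (p 1F) ⟩
        Q (t *ᵥ p) ∎)

      h-cong : ∀ {p q} → p ≋ q → h p ≈ h q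
      h-cong {p} {q} p≋q = √-unique (0≤h q) (trans (h² q)
        (+-cong (*-cong (sym (p≋q 1F)) (sym (p≋q 1F)))
          (*-congˡ (*-cong (sym (p≋q 0F)) (sym (p≋q 0F))))))

    parabolicNorm : Norm 2
    parabolicNorm = record
      { ‖_‖         = λ p → s * (∣ p 1F ∣ + h p)
      ; cong        = λ {p} {q} p≋q → *-congˡ (+-cong (∣∣-cong (p≋q 1F)) (h-cong {p} {q} p≋q))
      ; nonneg      = λ p → *-nonneg (proj₁ 0<s) (+-nonneg (∣∣-nonneg _) (0≤h p))
      ; definite    = λ p eq →
          let sum≈0 = x*y≈0⇒y≈0 (λ s≈0 → proj₂ 0<s (sym s≈0)) eq
              ∣y∣≈0 = x+y≈0⇒x≈0 (∣∣-nonneg _) (0≤h p) sum≈0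
              h≈0   = x+y≈0⇒y≈0 (∣∣-nonneg _) (0≤h p) sum≈0
              Q≈0   = trans (sym (h² p)) (trans (*-congˡ h≈0) (zeroʳ _))
              Ax²≈0 = x+y≈0⇒y≈0 (0≤x*x _) (*-nonneg (proj₁ 0<A) (0≤x*x _)) Q≈0
          in ≋-coordinates
               (x*x≈0⇒x≈0 (x*y≈0⇒y≈0 (λ A≈0 → proj₂ 0<A (sym A≈0)) Ax²≈0))
               (x*x≈0⇒x≈0 (trans (sym (∣∣-square _)) (trans (*-congˡ ∣y∣≈0) (zeroʳ _))))
      ; homogeneous = λ t p → trans (*-congˡ (+-cong (∣∣-* t (p 1F)) (h-homogeneous t p)))
          (solve 4 (λ s t a b → s :* (t :* a :+ t :* b) := t :* (s :* (a :+ b)))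
            refl s ∣ t ∣ ∣ p 1F ∣ (h p))
      ; triangle    = λ p q → ≤-respʳ-≈
          (solve 5 (λ s a b c d → s :* (a :+ b :+ (c :+ d)) := s :* (a :+ c) :+ s :* (b :+ d))
            refl s ∣ p 1F ∣ ∣ q 1F ∣ (h p) (h q))
          (*-monoˡ-≤ s (proj₁ 0<s) (+-mono-≤ (∣∣-triangle _ _) (h-triangle p q)))
      }

    open Norm parabolicNorm using (‖_‖) renaming (cong to ‖‖-cong)

    -- On the arcs the root is exact: (B - x²)² + 4 B x² = (B + x²)². Only squares of coordinates
    -- are prescribed, so that reversing a segment does no harm.
    unit-vector : ∀ p {x²} → 0# ≤ x² → x² ≤ B → p 0F * p 0F ≈ x² →
                  p 1F * p 1F ≈ (B - x²) * (B - x²) → ‖ p ‖ ≈ 1#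
    unit-vector p {x²} 0≤x² x²≤B x-eq y-eq = begin
      s * (∣ p 1F ∣ + h p)      ≈⟨ *-congˡ (+-cong (∣∣-unique (0≤y-x x²≤B) (sym y-eq))
                                   (√-unique (+-nonneg (proj₁ 0<B) 0≤x²) h-eq)) ⟩
      s * (B - x² + (B + x²))   ≈⟨ solve 3 (λ s b x → s :* (b :- x :+ (b :+ x)) := :2 :* b :* s)
                                     refl s B x² ⟩
      2# * B * s                ≈⟨ 2B*s ⟩
      1# ∎
      where
      h-eq : (B + x²) * (B + x²) ≈ Q p
      h-eq = trans (solve 2 (λ b x → (b :+ x) :* (b :+ x)
          := (b :- x) :* (b :- x) :+ :2 :* (:2 :* b) :* x) refl B x²)
        (sym (+-cong y-eq (*-congˡ x-eq)))

    private
      -- Norm one makes the root equal to 2 B - |y|; squaring cancels y² and leaves a multiple of 4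
      -- B.
      unit-equation : ∀ p → ‖ p ‖ ≈ 1# → p 0F * p 0F ≈ B - ∣ p 1F ∣
      unit-equation p eq = x-y≈0⇒x≈y (x*y≈0⇒y≈0 (λ A≈0 → proj₂ 0<A (sym A≈0)) (begin
        A * (x² - (B - a))
          ≈⟨ solve 4 (λ b a x y → :2 :* (:2 :* b) :* (x :- (b :- a))
               := (y :+ :2 :* (:2 :* b) :* x) :- (:2 :* b :- a) :* (:2 :* b :- a) :+ (a :* a :- y))
               refl B a x² (p 1F * p 1F) ⟩
        Q p - (2# * B - a) * (2# * B - a) + (a * a - p 1F * p 1F)
          ≈⟨ +-cong (+-cong (sym (h² p)) (-‿cong (*-cong (sym h≈) (sym h≈))))
               (trans (+-congʳ (∣∣-square _)) (-‿inverseʳ _)) ⟩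
        h p * h p - h p * h p + 0#
          ≈⟨ solve 1 (λ h → h :- h :+ :0 := :0) refl (h p * h p) ⟩
        0# ∎))
        where
        x² a : Carrier
        x² = p 0F * p 0F
        a = ∣ p 1F ∣
        h≈ : h p ≈ 2# * B - a
        h≈ = begin
          h p                              ≈⟨ solve 2 (λ h a → h := :1 :* (a :+ h) :- a) refl (h p) a ⟩
          1# * (a + h p) - a               ≈⟨ +-congʳ (*-congʳ 2B*s) ⟨
          2# * B * s * (a + h p) - a       ≈⟨ +-congʳ (*-assoc _ s _) ⟩
          2# * B * (s * (a + h p)) - a     ≈⟨ +-congʳ (*-congˡ eq) ⟩
          2# * B * 1# - a                  ≈⟨ +-congʳ (*-identityʳ _) ⟩
          2# * B - a ∎

      parallelogram : ∀ {x y m} → 2# * m ≈ x + y →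
        (x - y) * (x - y) ≈ 2# * (x * x + y * y) - 2# * (2# * (m * m))
      parallelogram {x} {y} {m} eq = begin
        (x - y) * (x - y)
          ≈⟨ solve 2 (λ x y → (x :- y) :* (x :- y)
               := :2 :* (x :* x :+ y :* y) :- (x :+ y) :* (x :+ y)) refl x y ⟩
        2# * (x * x + y * y) - (x + y) * (x + y)
          ≈⟨ +-congˡ (-‿cong (*-cong eq eq)) ⟨
        2# * (x * x + y * y) - 2# * m * (2# * m)
          ≈⟨ +-congˡ (-‿cong (solve 1 (λ m → :2 :* m :* (:2 :* m) := :2 :* (:2 :* (m :* m))) refl m)) ⟩
        2# * (x * x + y * y) - 2# * (2# * (m * m)) ∎

      -- With x² = B - |y| at all three points, the parallelogram law makes the squared difference
      -- of the abscissas equal to 2 (2 c - a - b), which is at most 0 by the triangle inequality.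
      -- So the abscissas agree, hence all y² agree, and the same law gives equal ordinates.
      unit-midpoint : ∀ p q m → (∀ i → 2# * m i ≈ p i + q i) →
        ‖ p ‖ ≈ 1# → ‖ q ‖ ≈ 1# → ‖ m ‖ ≈ 1# → p ≋ q
      unit-midpoint p q m mid p-unit q-unit m-unit = ≋-coordinates x≈ y≈
        where
        a b c : Carrier
        a = ∣ p 1F ∣
        b = ∣ q 1F ∣
        c = ∣ m 1F ∣

        2c≤a+b : 2# * c ≤ a + b
        2c≤a+b = ≤-respˡ-≈ (∣∣-unique (*-nonneg (proj₁ 0<2) (∣∣-nonneg _)) (begin
          2# * c * (2# * c)
            ≈⟨ solve 1 (λ c → :2 :* c :* (:2 :* c) := :2 :* (:2 :* (c :* c))) refl c ⟩
          2# * (2# * (c * c))             ≈⟨ *-congˡ (*-congˡ (∣∣-square _)) ⟩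
          2# * (2# * (m 1F * m 1F))
            ≈⟨ solve 1 (λ c → :2 :* (:2 :* (c :* c)) := :2 :* c :* (:2 :* c)) refl (m 1F) ⟩
          2# * m 1F * (2# * m 1F)         ≈⟨ *-cong (mid 1F) (mid 1F) ⟩
          (p 1F + q 1F) * (p 1F + q 1F) ∎)) (∣∣-triangle (p 1F) (q 1F))

        x≈ : p 0F ≈ q 0F
        x≈ = x-y≈0⇒x≈y (x*x≈0⇒x≈0 (antisym
          (≤-by (*-nonneg (proj₁ 0<2) (0≤y-x 2c≤a+b)) (begin
            2# * (a + b - 2# * c)
              ≈⟨ solve 4 (λ B a b c → :2 :* (a :+ b :- :2 :* c)
                   := :0 :- (:2 :* ((B :- a) :+ (B :- b)) :- :2 :* (:2 :* (B :- c)))) refl B a b c ⟩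
            0# - (2# * ((B - a) + (B - b)) - 2# * (2# * (B - c)))
              ≈⟨ +-congˡ (-‿cong (+-cong
                   (*-congˡ (+-cong (unit-equation p p-unit) (unit-equation q q-unit)))
                   (-‿cong (*-congˡ (*-congˡ (unit-equation m m-unit)))))) ⟨
            0# - (2# * (p 0F * p 0F + q 0F * q 0F) - 2# * (2# * (m 0F * m 0F)))
              ≈⟨ +-congˡ (-‿cong (parallelogram (mid 0F))) ⟨
            0# - (p 0F - q 0F) * (p 0F - q 0F) ∎))
          (0≤x*x _)))

        m≈p : m 0F ≈ p 0F
        m≈p = begin
          m 0F                    ≈⟨ *-identityˡ _ ⟨
          1# * m 0F               ≈⟨ *-congʳ 2*½ ⟨
          2# * ½ * m 0F           ≈⟨ solve 2 (λ h m → :2 :* h :* m := h :* (:2 :* m)) refl ½ (m 0F) ⟩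
          ½ * (2# * m 0F)         ≈⟨ *-congˡ (trans (mid 0F) (+-congˡ (sym x≈))) ⟩
          ½ * (p 0F + p 0F)       ≈⟨ solve 2 (λ h m → h :* (m :+ m) := :2 :* h :* m) refl ½ (p 0F) ⟩
          2# * ½ * p 0F           ≈⟨ *-congʳ 2*½ ⟩
          1# * p 0F               ≈⟨ *-identityˡ _ ⟩
          p 0F ∎

        same-height : ∀ u v → ‖ u ‖ ≈ 1# → ‖ v ‖ ≈ 1# → u 0F ≈ v 0F → u 1F * u 1F ≈ v 1F * v 1F
        same-height u v u-unit v-unit eq =
          trans (sym (∣∣-square _)) (trans (*-cong ∣∣≈ ∣∣≈) (∣∣-square _))
          where
          ∣∣≈ : ∣ u 1F ∣ ≈ ∣ v 1F ∣
          ∣∣≈ = x-y≈0⇒x≈y (trans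
            (solve 3 (λ B a b → a :- b := (B :- b) :- (B :- a)) refl B ∣ u 1F ∣ ∣ v 1F ∣)
            (trans (+-cong (sym (unit-equation v v-unit)) (-‿cong (sym (unit-equation u u-unit))))
              (trans (+-congˡ (-‿cong (*-cong eq eq))) (-‿inverseʳ _))))

        y≈ : p 1F ≈ q 1F
        y≈ = x-y≈0⇒x≈y (x*x≈0⇒x≈0 (begin
          (p 1F - q 1F) * (p 1F - q 1F)
            ≈⟨ parallelogram (mid 1F) ⟩
          2# * (p 1F * p 1F + q 1F * q 1F) - 2# * (2# * (m 1F * m 1F))
            ≈⟨ +-cong (*-congˡ (+-congˡ (same-height q p q-unit p-unit (sym x≈))))
                 (-‿cong (*-congˡ (*-congˡ (same-height m p m-unit p-unit m≈p)))) ⟩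
          2# * (p 1F * p 1F + p 1F * p 1F) - 2# * (2# * (p 1F * p 1F))
            ≈⟨ solve 1 (λ y → :2 :* (y :* y :+ y :* y) :- :2 :* (:2 :* (y :* y)) := :0) refl (p 1F) ⟩
          0# ∎))

    -- A segment on the unit sphere would have its ends and its midpoint there, at the parameters 0,
    -- 1 and `½`.
    strictlyConvex : StrictlyConvex parabolicNorm
    strictlyConvex (p , q , p≉q , unit) = p≉q (unit-midpoint p q (at ½) mid
      (trans (‖‖-cong (at0 p q)) (unit 0# ≤-refl 0≤1))
      (trans (‖‖-cong (at1 p q)) (unit 1# 0≤1 ≤-refl))
      (unit ½ (proj₁ 0<½) (≤-by (proj₁ 0<½) (trans
        (solve 1 (λ h → h := :2 :* h :- h) refl ½) (+-congʳ 2*½)))))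
      where
      0<½ : 0# < ½
      0<½ = inverse-pos 0<2 2*½

      at : Carrier → Point 2
      at t = (1# + - t) *ᵥ p +ᵥ t *ᵥ q

      at0 : ∀ p q → p ≋ (1# + - 0#) *ᵥ p +ᵥ 0# *ᵥ q
      at0 p q i = solve 2 (λ p q → p := (:1 :- :0) :* p :+ :0 :* q) refl (p i) (q i)

      at1 : ∀ p q → q ≋ (1# + - 1#) *ᵥ p +ᵥ 1# *ᵥ q
      at1 p q i = solve 2 (λ p q → q := (:1 :- :1) :* p :+ :1 :* q) refl (p i) (q i)

      mid : ∀ i → 2# * at ½ i ≈ p i + q i
      mid i = begin
        2# * ((1# - ½) * p i + ½ * q i)
          ≈⟨ solve 3 (λ h p q → :2 :* ((:1 :- h) :* p :+ h :* q)
               := (:2 :- :2 :* h) :* p :+ :2 :* h :* q) refl ½ (p i) (q i) ⟩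
        (2# - 2# * ½) * p i + 2# * ½ * q i
          ≈⟨ +-cong (*-congʳ (+-congˡ (-‿cong 2*½))) (*-congʳ 2*½) ⟩
        (2# - 1#) * p i + 1# * q i
          ≈⟨ solve 2 (λ p q → (:2 :- :1) :* p :+ :1 :* q := p :+ q) refl (p i) (q i) ⟩
        p i + q i ∎

  -- Natural numbers in the field and a bound on the logarithm.

  fromℕ-< : ∀ {m n} → m ℕ.< n → fromℕ m < fromℕ n
  fromℕ-< {m} {n} m<n = ·1-mono (ℕₚ.<⇒≤ m<n) , λ m≈n → 0<⇒≰0 0<1
    (+-cancelʳ-≤ (fromℕ m) (≤-respʳ-≈ (trans (sym m≈n) (sym (+-identityˡ _))) (·1-mono m<n)))

  fromℕ-injective : ∀ {m n} → fromℕ m ≈ fromℕ n → m ≡ n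
  fromℕ-injective {m} {n} eq with ℕₚ.<-cmp m n
  ... | tri< m<n _ _ = contradiction eq (proj₂ (fromℕ-< m<n))
  ... | tri≈ _ m≡n _ = m≡n
  ... | tri> _ _ n<m = contradiction (sym eq) (proj₂ (fromℕ-< n<m))

  -- For every rational p / q below the logarithm, 2 to the power p is at most n to the power q,
  -- hence at most 2 to the power q m; so p ≤ q m.
  log₂-≤ : ∀ n m → n ℕ.≤ 2 ℕ.^ m → log₂ n ≤ fromℕ m
  log₂-≤ zero      m _ = ·1-nonneg m
  log₂-≤ n@(suc _) m n≤2^m = proj₂ (proj₂ (log₂-supremum n (ℕ.s≤s ℕ.z≤n))) (fromℕ m)
    λ y (p , q , 1≤q , qy≈p , 2^p≤n^q) → ·-cancel-≤ q 1≤q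
      (≤-respˡ-≈ (sym qy≈p) (≤-respʳ-≈ (sym (×-assocˡ 1# q m)) (·1-mono (p≤q*m p q 2^p≤n^q))))
    where
    p≤q*m : ∀ p q → 2 ℕ.^ p ℕ.≤ n ℕ.^ q → p ℕ.≤ q ℕ.* m
    p≤q*m p q 2^p≤n^q = ℕₚ.≮⇒≥ λ qm<p → ℕₚ.<⇒≱ (ℕₚ.^-monoʳ-< 2 (ℕ.s≤s (ℕ.s≤s ℕ.z≤n)) qm<p)
      (ℕₚ.≤-trans 2^p≤n^q (ℕₚ.≤-trans (ℕₚ.^-monoˡ-≤ q n≤2^m)
        (ℕₚ.≤-reflexive (≡.trans (ℕₚ.^-*-assoc 2 m q) (≡.cong (2 ℕ.^_) (ℕₚ.*-comm m q))))))

  -- From incidences to midpoints, sums and unit segments.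

  module _ {#U #V #X n} (I : Incidences #U #V #X) (fits : #U ℕ.+ #V ℕ.≤ n) where
    open Incidences I

    p : Fin #U → Point 2
    p i = ⟨ fromℕ (U i) , fromℕ (U i) * fromℕ (U i) - 2# * fromℕ (F i) ⟩

    r : Fin #V → Point 2
    r l = ⟨ fromℕ (V l) , fromℕ (V l) * fromℕ (V l) + 2# * fromℕ (G l) ⟩

    X : Fin #X → Carrier
    X a = fromℕ (U (pointOf a)) + fromℕ (V (lineOf a))

    X≈ : ∀ a → X a ≈ fromℕ (U (pointOf a) ℕ.+ V (lineOf a))
    X≈ a = sym (×-homo-+ 1# (U (pointOf a)) (V (lineOf a)))

    X-injective : ∀ {a b} → X a ≈ X b → a ≡ b
    X-injective {a} {b} eq =
      U+V-injective a b (fromℕ-injective {U (pointOf a) ℕ.+ _} {U (pointOf b) ℕ.+ _} (trans (sym (X≈ a)) (trans eq (X≈ b))))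

    0≤X : ∀ a → 0# ≤ X a
    0≤X a = +-nonneg (·1-nonneg (U (pointOf a))) (·1-nonneg (V (lineOf a)))

    sum₁ : ∀ a → p (pointOf a) 1F + r (lineOf a) 1F ≈ X a * X a
    sum₁ a = begin
      u * u - 2# * f + (v * v + 2# * fromℕ (G (lineOf a)))  ≈⟨ +-congˡ (+-congˡ (*-congˡ incident′)) ⟨
      u * u - 2# * f + (v * v + 2# * (f + u * v))
        ≈⟨ solve 3 (λ u v f → u :* u :- :2 :* f :+ (v :* v :+ :2 :* (f :+ u :* v))
             := (u :+ v) :* (u :+ v)) refl u v f ⟩
      (u + v) * (u + v) ∎
      where
      u v f : Carrier
      u = fromℕ (U (pointOf a))
      v = fromℕ (V (lineOf a))
      f = fromℕ (F (pointOf a))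
      incident′ : f + u * v ≈ fromℕ (G (lineOf a))
      incident′ = trans (+-congˡ (sym (×1-homo-* (U (pointOf a)) _)))
        (trans (sym (×-homo-+ 1# (F (pointOf a)) _)) (×-congˡ {1#} (incident a)))

    p+r : ∀ a → p (pointOf a) +ᵥ r (lineOf a) ≋ ⟨ X a , X a * X a ⟩
    p+r a = ≋-coordinates refl (sum₁ a)

    parabola : PointSet 2 #X
    parabola = record
      { point    = λ a → ⟨ X a , X a * X a ⟩
      ; distinct = λ eq → X-injective (eq 0F)
      }

    halved : PointSet 2 #X
    halved = record
      { point    = λ a → ½ *ᵥ ⟨ X a , X a * X a ⟩
      ; distinct = λ {a} {b} eq → X-injective
          (trans (sym (double (X a))) (trans (*-congˡ (eq 0F)) (double (X b))))
      }
      where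
      double : ∀ x → 2# * (½ * x) ≈ x
      double x = trans (sym (*-assoc _ _ _)) (trans (*-congʳ 2*½) (*-identityˡ x))

    E≥ : ∃[ e ] IsE 2 n e × #X ℕ.≤ e
    E≥ with P , p∈ , r∈ ← cover₂ fits p r =
      E-maximum P (proj₁ ∘ pair , halved , midpoint≋ ,
        -- Halving (X , X²) leads to the parabola y = 2 x².
        parabola-convexlyIndependent halved 2# 0<2 λ a →
          trans (trans (sym (*-identityˡ _)) (*-congʳ (sym 2*½)))
            (solve 2 (λ h x → :2 :* h :* (h :* (x :* x)) := :2 :* (h :* x :* (h :* x))) refl ½ (X a)))
      where
      p≉r : ∀ a → ¬ p (pointOf a) ≋ r (lineOf a)
      p≉r a eq = ℕₚ.<-irrefl (≡.sym (fromℕ-injective {U (pointOf a)} (eq 0F))) (V<U a)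
      pair = λ a → pairOf P (p∈ (pointOf a)) (r∈ (lineOf a)) (p≉r a)
      midpoint≋ : ∀ a → point halved a ≋ midpointOf P (proj₁ (pair a))
      midpoint≋ a t = *-congˡ (trans (sym (p+r a t)) (sum≈ (proj₂ (pair a))))
        where
        sum≈ : _ → _
        sum≈ (inj₁ (p≋ , r≋)) = +-cong (p≋ t) (r≋ t)
        sum≈ (inj₂ (p≋ , r≋)) = trans (+-comm _ _) (+-cong (r≋ t) (p≋ t))

    M≥ : ∃[ m ] IsM 2 n n m × #X ℕ.≤ m
    M≥ with P , p∈ ← cover (ℕₚ.m+n≤o⇒m≤o #U fits) p
       with Q , r∈ ← cover (ℕₚ.m+n≤o⇒n≤o #U fits) r =
      M-maximum P Q parabola
        (λ (a , x≋) → p (pointOf a) , r (lineOf a) , p∈ _ , r∈ _ ,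
          λ t → trans (x≋ t) (sym (p+r a t)))
        (parabola-convexlyIndependent parabola 1# 0<1 λ a → sym (*-identityˡ _))

    W≥ : ∃[ w ] IsW 2 n w × #X ℕ.≤ w
    W≥ = W-maximum (parabolicNorm B 0<B) (strictlyConvex B 0<B) P (proj₁ ∘ pair) unit nonparallel
      where
      -- `B` has to dominate every X² so that all differences reach the arcs |y| = B - x².
      bound = bounded (λ a → X a * X a)

      B : Carrier
      B = proj₁ bound

      0<B : 0# < B
      0<B = proj₁ (proj₂ bound)

      X²≤B : ∀ a → X a * X a ≤ B
      X²≤B a = proj₁ (proj₂ (proj₂ bound) a)

      open Norm (parabolicNorm B 0<B) using (‖_‖; homogeneous) renaming (cong to ‖‖-cong)

      -- The point reflection that takes `r` to (0 , B) - r turns the sums p + r into differences,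
      -- up to the constant (0 , B).
      r′ : Fin #V → Point 2
      r′ l = ⟨ - r l 0F , B - r l 1F ⟩

      covering = cover₂ fits p r′

      P : PointSet 2 n
      P = proj₁ covering

      -- Equality would give X = 0, but `V<U` makes `U` positive.
      p≉r′ : ∀ a → ¬ p (pointOf a) ≋ r′ (lineOf a)
      p≉r′ a eq = ℕₚ.m<n⇒n≢0 (V<U a) (ℕₚ.m+n≡0⇒m≡0 (U (pointOf a)) (fromℕ-injective
        {U (pointOf a) ℕ.+ V (lineOf a)} {0} (trans (sym (X≈ a)) (trans (+-congʳ (eq 0F)) (-‿inverseˡ _)))))

      pair = λ a → pairOf P (proj₁ (proj₂ covering) (pointOf a)) (proj₂ (proj₂ covering) (lineOf a)) (p≉r′ a)

      d : Fin #X → Point 2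
      d a = difference P (proj₁ (pair a))

      -- Only squares are compared, since the selection of the pair may reverse d a.

      swap² : ∀ x y → (x - y) * (x - y) ≈ (y - x) * (y - x)
      swap² = solve 2 (λ x y → (x :- y) :* (x :- y) := (y :- x) :* (y :- x)) refl

      d² : ∀ a t → d a t * d a t ≈ (p (pointOf a) t - r′ (lineOf a) t) * (p (pointOf a) t - r′ (lineOf a) t)
      d² a t with pair a
      ... | _ , inj₁ (p≋ , r≋) = sym (*-cong p-r p-r)
        where p-r = +-cong (p≋ t) (-‿cong (r≋ t))
      ... | _ , inj₂ (p≋ , r≋) = trans (swap² _ _) (sym (*-cong p-r p-r))
        where p-r = +-cong (p≋ t) (-‿cong (r≋ t))

      d₀² : ∀ a → d a 0F * d a 0F ≈ X a * X a
      d₀² a = trans (d² a 0F) (solve 2 (λ u v → (u :- (:- v)) :* (u :- (:- v)) := (u :+ v) :* (u :+ v)) refl _ _)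

      d₁² : ∀ a → d a 1F * d a 1F ≈ (B - X a * X a) * (B - X a * X a)
      d₁² a = begin
        d a 1F * d a 1F  ≈⟨ d² a 1F ⟩
        (y - (B - z)) * (y - (B - z))
          ≈⟨ solve 3 (λ y B z → (y :- (B :- z)) :* (y :- (B :- z))
               := (B :- (y :+ z)) :* (B :- (y :+ z))) refl y B z ⟩
        (B - (y + z)) * (B - (y + z))
          ≈⟨ *-cong (+-congˡ (-‿cong (sum₁ a))) (+-congˡ (-‿cong (sum₁ a))) ⟩
        (B - X a * X a) * (B - X a * X a) ∎
        where
        y z : Carrier
        y = p (pointOf a) 1F
        z = r (lineOf a) 1F

      unit : ∀ a → ‖ d a ‖ ≈ 1#
      unit a = unit-vector B 0<B (d a) (0≤x*x _) (X²≤B a) (d₀² a) (d₁² a)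

      -- Parallel vectors of norm one differ by a factor with square 1, so they share X²; and the
      -- nonnegative `X` distinguishes the incidences.
      nonparallel : ∀ a b → a ≢ b → ¬ Parallel (d a) (d b)
      nonparallel a b a≢b (t , da≋tdb) =
        a≢b (X-injective (square-injective (0≤X a) (0≤X b) (begin
          X a * X a                      ≈⟨ d₀² a ⟨
          d a 0F * d a 0F                ≈⟨ *-cong (da≋tdb 0F) (da≋tdb 0F) ⟩
          t * d b 0F * (t * d b 0F)
            ≈⟨ solve 2 (λ t x → t :* x :* (t :* x) := t :* t :* (x :* x)) refl t (d b 0F) ⟩
          t * t * (d b 0F * d b 0F)      ≈⟨ *-cong tt≈1 (d₀² b) ⟩
          1# * (X b * X b)               ≈⟨ *-identityˡ _ ⟩
          X b * X b ∎)))
        where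
        ∣t∣≈1 : ∣ t ∣ ≈ 1#
        ∣t∣≈1 = begin
          ∣ t ∣               ≈⟨ *-identityʳ _ ⟨
          ∣ t ∣ * 1#          ≈⟨ *-congˡ (unit b) ⟨
          ∣ t ∣ * ‖ d b ‖     ≈⟨ homogeneous t (d b) ⟨
          ‖ t *ᵥ d b ‖        ≈⟨ ‖‖-cong {d a} {t *ᵥ d b} da≋tdb ⟨
          ‖ d a ‖             ≈⟨ unit a ⟩
          1# ∎
        tt≈1 : t * t ≈ 1#
        tt≈1 = trans (sym (∣∣-square t)) (trans (*-cong ∣t∣≈1 ∣t∣≈1) (*-identityˡ 1#))

  -- The constant and the final estimate.

  c : Carrier
  c = ½ * (½ * ½)

  0<½ : 0# < ½
  0<½ = inverse-pos 0<2 2*½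

  0<c : 0# < c
  0<c = *-pos 0<½ (*-pos 0<½ 0<½)

  -- The root is at most 2 k, and n k is at most 4 m; the two losses, 2 and 4, make up the constant
  -- 1/8.
  n√log-≤ : ∀ {n k m} → n ℕ.≤ 2 ℕ.^ ((2 ℕ.* k) ℕ.* (2 ℕ.* k)) → n ℕ.* k ℕ.≤ 4 ℕ.* m →
            c * (fromℕ n * √ (log₂ n)) ≤ fromℕ m
  n√log-≤ {n} {k} {m} n≤ nk≤4m = ≤-trans
    (*-monoˡ-≤ c (proj₁ 0<c) (*-monoˡ-≤ (fromℕ n) (·1-nonneg n) √log≤2k))
    (≤-respˡ-≈ (sym c*n*2k) (≤-respʳ-≈ quarter*4m
      (*-monoˡ-≤ (½ * ½) (*-nonneg (proj₁ 0<½) (proj₁ 0<½)) (·1-mono nk≤4m))))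
    where
    √log≤2k : √ (log₂ n) ≤ fromℕ (2 ℕ.* k)
    √log≤2k = √-≤ (·1-nonneg (2 ℕ.* k))
      (≤-respʳ-≈ (×1-homo-* (2 ℕ.* k) (2 ℕ.* k)) (log₂-≤ n ((2 ℕ.* k) ℕ.* (2 ℕ.* k)) n≤))

    fromℕ-2* : ∀ j → fromℕ (2 ℕ.* j) ≈ 2# * fromℕ j
    fromℕ-2* j = trans (×1-homo-* 2 j) (*-congʳ (+-congˡ (+-identityʳ 1#)))

    c*n*2k : c * (fromℕ n * fromℕ (2 ℕ.* k)) ≈ ½ * ½ * fromℕ (n ℕ.* k)
    c*n*2k = begin
      c * (fromℕ n * fromℕ (2 ℕ.* k))            ≈⟨ *-congˡ (*-congˡ (fromℕ-2* k)) ⟩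
      c * (fromℕ n * (2# * fromℕ k))
        ≈⟨ solve 3 (λ h n k → h :* (h :* h) :* (n :* (:2 :* k)) := :2 :* h :* (h :* h :* (n :* k)))
             refl ½ (fromℕ n) (fromℕ k) ⟩
      2# * ½ * (½ * ½ * (fromℕ n * fromℕ k))     ≈⟨ *-cong 2*½ (*-congˡ (sym (×1-homo-* n k))) ⟩
      1# * (½ * ½ * fromℕ (n ℕ.* k))             ≈⟨ *-identityˡ _ ⟩
      ½ * ½ * fromℕ (n ℕ.* k) ∎

    quarter*4m : ½ * ½ * fromℕ (4 ℕ.* m) ≈ fromℕ m
    quarter*4m = begin
      ½ * ½ * fromℕ (4 ℕ.* m)                    ≈⟨ *-congˡ (×-congˡ {1#} (ℕₚ.*-assoc 2 2 m)) ⟩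
      ½ * ½ * fromℕ (2 ℕ.* (2 ℕ.* m))            ≈⟨ *-congˡ (trans (fromℕ-2* (2 ℕ.* m)) (*-congˡ (fromℕ-2* m))) ⟩
      ½ * ½ * (2# * (2# * fromℕ m))
        ≈⟨ solve 2 (λ h m → h :* h :* (:2 :* (:2 :* m)) := :2 :* h :* (:2 :* h) :* m) refl ½ (fromℕ m) ⟩
      2# * ½ * (2# * ½) * fromℕ m                ≈⟨ *-congʳ (*-cong 2*½ 2*½) ⟩
      1# * 1# * fromℕ m                          ≈⟨ trans (*-congʳ (*-identityˡ 1#)) (*-identityˡ _) ⟩
      fromℕ m ∎

theorem5 : ExcludedMiddle 0ℓ → (ℝ : CompleteOrderedField) →
    let open CompleteOrderedField ℝ
        open RealNumbers ℝ
        open ConvexGeometry ℝ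
    in ∃[ c ] 0# < c × ∃[ n₀ ] ∀ (n : ℕ) → n₀ ℕ.≤ n →
         (∃[ e ] IsE 2 n e × c * (fromℕ n * √ (log₂ n)) ≤ fromℕ e) ×
         (∃[ m ] IsM 2 n n m × c * (fromℕ n * √ (log₂ n)) ≤ fromℕ m) ×
         (∃[ w ] IsW 2 n w × c * (fromℕ n * √ (log₂ n)) ≤ fromℕ w)
-- From n = 2 on, k = 1 satisfies 2 kᵏ ≤ n, so a grid can be chosen.
theorem5 em ℝ = c , 0<c , 2 , λ n 2≤n →
  let (k , _ , _ , #X , I , fits , nk≤4#X , n≤2^4k²) = incidences-exist n 2≤n
      at-least = λ {m} (#X≤m : #X ℕ.≤ m) → n√log-≤ {n} {k} {m} n≤2^4k²
                   (ℕₚ.≤-trans nk≤4#X (ℕₚ.*-monoʳ-≤ 4 #X≤m))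
      (e , isE , #X≤e) = E≥ I fits
      (m , isM , #X≤m) = M≥ I fits
      (w , isW , #X≤w) = W≥ I fits
  in (e , isE , at-least #X≤e) , (m , isM , at-least #X≤m) , (w , isW , at-least #X≤w)
  where open LowerBounds em ℝ
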